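{- Let $d\ge1$ and let $H$ be a $(d+1)$-uniform hypergraph on a finite vertex set. Then the Ehrhart polynomial of $\mathcal{Z}_H$ (with respect to the lattice $Z_{d-1}(H;\mathbb{Z})$) is \[L(\mathcal{Z}_H,t)=\sum_{F}\bigl|\tilde H_{d-1}(F;\mathbb{Z})_{\mathrm{tors}}\bigr|\,t^{|E(F)|},\] where the sum is over all spanning hyperforests $F$ of $H$ and $A_{\mathrm{tors}}$ denotes the subgroup of torsion elements of an abelian group $A$.
   Context: A $(d+1)$-uniform hypergraph $H$ is regarded as the simplicial complex with vertex set $V(H)$ whose simplices are all edges of $H$ together with all nonempty subsets of $V(H)$ of size at most $d$. For a simplicial complex $X$ and $R\in\{\mathbb{Z},\mathbb{R}\}$, $C_k(X;R)$ is the free $R$-module on symbols $(v_0\cdots v_k)$ for $k$-simplices, with $(v_{\pi(0)}\cdots v_{\pi(k)})=\operatorname{sgn}\pi\,(v_0\cdots v_k)$; $\partial_k(v_0\cdots v_k)=\sum_i(-1)^i(v_0\cdots\hat v_i\cdots v_k)$ for $k\ge1$, and $\partial_0$ sends each $(v)$ to $1\in R$. $Z_k=\ker\partial_k$, $B_k=\operatorname{im}\partial_{k+1}$, $\tilde H_k(X;R)=Z_k/B_k$. The hypergraphic zonotope $\mathcal{Z}_H\subseteq Z_{d-1}(H;\mathbb{R})$ is the Minkowski sum over the edges $\{v_0,\dots,v_d\}$ of $H$ (each once, arbitrary vertex ordering) of the segments $\operatorname{conv}\{0,\partial_d((v_0\cdots v_d))\}$, well defined up to translation by $Z_{d-1}(H;\mathbb{Z})$.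 The integral points are those of $Z_{d-1}(H;\mathbb{Z})$, and $L(\mathcal{Z}_H,t)$ denotes, for each positive integer $t$, the number of points of $Z_{d-1}(H;\mathbb{Z})$ in $t\mathcal{Z}_H$. A hyperforest is a $(d+1)$-uniform hypergraph $F$ with $\tilde H_d(F;\mathbb{R})=0$; a spanning hyperforest of $H$ is a hyperforest with the same vertex set as $H$ whose edges are edges of $H$.
   Formalization: The coefficients in the Minkowski sum defining the dilates of the zonotope, and the coefficient field in the hyperforest condition (vanishing of the d-th reduced homology), are taken rational instead of real. -}

module Defs where

open import Data.Nat as ℕ using (ℕ; zero; suc)
open import Data.Integer as ℤ using (ℤ; +_; 0ℤ; 1ℤ)
open import Data.Rational as ℚ using (ℚ; 0ℚ)
open import Data.Fin using (Fin; zero; suc)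
open import Data.Fin.Properties using (_<?_)
open import Data.Fin.Subset using (Subset; ∣_∣; _∪_; ⁅_⁆; _∈_)
open import Data.Fin.Subset.Properties using (_∈?_)
open import Data.Vec using (Vec; []; _∷_)
open import Data.Vec.Properties using (≡-dec)
open import Data.List using (List; []; _∷_; map; _++_; foldr)
open import Data.Bool using (Bool; true; false; if_then_else_; _∧_)
import Data.Bool as B
open import Data.Product using (Σ; Σ-syntax; ∃; ∃-syntax; _×_)
open import Relation.Nullary using (¬_; Dec)
open import Relation.Nullary.Decidable using (⌊_⌋)
open import Relation.Binary.PropositionalEquality using (_≡_; _≢_)
open import Function using (_∘_)

sumFinℕ : ∀ {m} → (Fin m → ℕ) → ℕ
sumFinℕ {zero} f = 0
sumFinℕ {suc m} f = f zero ℕ.+ sumFinℕ (f ∘ suc)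

sumFinℤ : ∀ {m} → (Fin m → ℤ) → ℤ
sumFinℤ {zero} f = 0ℤ
sumFinℤ {suc m} f = f zero ℤ.+ sumFinℤ (f ∘ suc)

sumFinℚ : ∀ {m} → (Fin m → ℚ) → ℚ
sumFinℚ {zero} f = 0ℚ
sumFinℚ {suc m} f = f zero ℚ.+ sumFinℚ (f ∘ suc)

allSubsets : (m : ℕ) → List (Subset m)
allSubsets zero = [] ∷ []
allSubsets (suc m) = map (true ∷_) (allSubsets m) ++ map (false ∷_) (allSubsets m)

toℚ : ℤ → ℚ
toℚ z = z ℚ./ 1

sgn : ℕ → ℤ
sgn zero = 1ℤ
sgn (suc k) = ℤ.- sgn k

-- Integer chains on the vertex set Fin n: a simplex {v_0 < ... < v_k} is the
-- subset it spans, oriented by the vertex order; a k-chain is a coefficient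
-- function supported on subsets of size k+1.
Chain : ℕ → Set
Chain n = Subset n → ℤ

below : ∀ {n} → Subset n → Fin n → ℕ
below τ v = sumFinℕ (λ u → if ⌊ u ∈? τ ⌋ ∧ ⌊ u <? v ⌋ then 1 else 0)

-- boundary: (∂c)(τ) = Σ_{v ∉ τ} (-1)^{#{u∈τ : u<v}} c(τ ∪ {v}).
-- On 0-chains this is the augmentation (value at the empty set).
bd : ∀ {n} → Chain n → Chain n
bd c τ = sumFinℤ (λ v → if ⌊ v ∈? τ ⌋ then 0ℤ else sgn (below τ v) ℤ.* c (τ ∪ ⁅ v ⁆))

_≟ₛ_ : ∀ {n} → (s t : Subset n) → Dec (s ≡ t)
_≟ₛ_ = ≡-dec B._≟_

δ : ∀ {n} → Subset n → Chain n
δ e s = if ⌊ s ≟ₛ e ⌋ then 1ℤ else 0ℤ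

record Hypergraph (d n : ℕ) : Set where
  field
    m        : ℕ
    edge     : Fin m → Subset n
    uniform  : ∀ i → ∣ edge i ∣ ≡ suc d
    distinct : ∀ i j → edge i ≡ edge j → i ≡ j
open Hypergraph public

module _ {d n : ℕ} (H : Hypergraph d n) where

  bdEdge : Fin (m H) → Chain n
  bdEdge i = bd (δ (edge H i))

  IsCycle : Chain n → Set
  IsCycle x = (∀ s → ∣ s ∣ ≢ d → x s ≡ 0ℤ) × (∀ τ → bd x τ ≡ 0ℤ)

  -- x ∈ t·Z_H, Z_H = Σ_e conv{0, ∂_d e}
  InDilate : ℕ → Chain n → Set
  InDilate t x = Σ[ λ' ∈ (Fin (m H) → ℚ) ]
    ((∀ i → (0ℚ ℚ.≤ λ' i) × (λ' i ℚ.≤ toℚ (+ t))) ×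
     (∀ s → toℚ (x s) ≡ sumFinℚ (λ i → λ' i ℚ.* toℚ (bdEdge i s))))

  LatticeCount : ℕ → ℕ → Set
  LatticeCount t N = Σ[ f ∈ (Fin N → Chain n) ]
    ((∀ i → IsCycle (f i) × InDilate t (f i)) ×
     (∀ i j → (∀ s → f i s ≡ f j s) → i ≡ j) ×
     (∀ x → IsCycle x → InDilate t x → ∃[ i ] (∀ s → f i s ≡ x s)))

  -- spanning subhypergraph F given by a set S of edge indices:
  -- H̃_d(F;ℚ) = ker ∂_d on C_d(F;ℚ) = 0
  IsHyperforest : Subset (m H) → Set
  IsHyperforest S = ∀ (λ' : Fin (m H) → ℚ) →
    (∀ s → sumFinℚ (λ i → if ⌊ i ∈? S ⌋ then λ' i ℚ.* toℚ (bdEdge i s) else 0ℚ) ≡ 0ℚ) →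
    ∀ i → i ∈ S → λ' i ≡ 0ℚ

  InB : Subset (m H) → Chain n → Set
  InB S y = Σ[ μ ∈ (Fin (m H) → ℤ) ]
    (∀ s → y s ≡ sumFinℤ (λ i → if ⌊ i ∈? S ⌋ then μ i ℤ.* bdEdge i s else 0ℤ))

  IsTors : Subset (m H) → Chain n → Set
  IsTors S z = IsCycle z × ∃[ k ] InB S (λ s → + suc k ℤ.* z s)

  TorsOrder : Subset (m H) → ℕ → Set
  TorsOrder S N = Σ[ f ∈ (Fin N → Chain n) ]
    ((∀ i → IsTors S (f i)) ×
     (∀ i j → InB S (λ s → f i s ℤ.- f j s) → i ≡ j) ×
     (∀ z → IsTors S z → ∃[ i ] InB S (λ s → z s ℤ.- f i s)))

{-# OPTIONS --safe #-}

-- Deletion-contraction over the edges.  For an abelian group G with elements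
-- v₁, …, v_m, let N(G; v₁, …, v_m) count the x ∈ G whose image in G ⊗ ℚ lies in
-- Σ [0, t] vᵢ.  If v₁ is torsion it can be dropped.  Otherwise every coset of
-- ℤ v₁ meeting the smaller zonotope over ℚ gains exactly t points when the
-- segment [0, t] v₁ is added, since a line meets a polytope in an interval:
--   N(G; v₁, v₂, …) = N(G; v₂, …) + t · N(G / v₁; v₂, …).
-- For m = 0 the count is |G_tors|, so unfolding the recursion gives one term
-- |(G / ⟨v_S⟩)_tors| t^|S| for every independent S.  Here G is the group of
-- (d-1)-cycles; quotients of G are represented by the submodule B divided out.

module Submission where

open import Defs
open import Data.Nat as ℕ using (ℕ; zero; suc)
import Data.Nat.Properties as ℕ
open import Data.Nat.ListAction using (sum)
open import Data.Nat.ListAction.Properties using (sum-++)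
import Algebra.Properties.CommutativeSemigroup ℕ.+-commutativeSemigroup as ℕ+
import Algebra.Properties.CommutativeSemigroup ℕ.*-commutativeSemigroup as ℕ*
open import Data.Integer as ℤ using (ℤ; +_; -[1+_]; 0ℤ; 1ℤ; +≤+)
open import Data.Integer.Properties as ℤ using (i≤j⇒0≤j-i; 0≤i-j⇒j≤i; i-j≡0⇒i≡j)
open import Data.Integer.DivMod using ([n/ℕd]*d≤n; n<s[n/ℕd]*d)
import Algebra.Properties.AbelianGroup ℤ.+-0-abelianGroup as ℤ+
open import Data.Integer.Tactic.RingSolver using (solve-∀)
open import Data.Rational as ℚ using (ℚ; 0ℚ; ↥_; ↧_; toℚᵘ)
import Data.Rational.Properties as ℚ
open import Data.Rational.Unnormalised as ℚᵘ using (mkℚᵘ; *≡*; *≤*)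
import Data.Rational.Unnormalised.Properties as ℚᵘ
open import Data.Bool using (Bool; true; false; if_then_else_; _∧_)
open import Data.Empty using (⊥-elim)
open import Data.Fin using (Fin; zero; suc; toℕ; fromℕ<; _<_)
open import Data.Fin.Properties as Fin using (_<?_; +↔⊎; *↔×; toℕ-fromℕ<; toℕ-injective; toℕ<n; ¬∀⟶∃¬)
open import Data.Fin.Subset using (Subset; ∣_∣; _∪_; ⁅_⁆; _∈_; _∉_)
open import Data.Fin.Subset.Properties using (_∈?_; anySubset?; ∪-identityʳ; ∪-assoc; ∪-comm; x∈p∪q⁺; x∈p∪q⁻; x∈⁅x⁆; x∈⁅y⁆⇒x≡y)
open import Data.List as List using (map; _++_)
import Data.List.Properties as List
open import Data.Product using (Σ-syntax; ∃-syntax; _×_; _,_; proj₁; proj₂)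
open import Data.Sum using (_⊎_; inj₁; inj₂; [_,_]′)
open import Data.Sum.Function.Propositional using (_⊎-↔_)
open import Data.Vec using ([]; _∷_; here; there; lookup)
open import Data.Vec.Functional using () renaming (_∷_ to _◂_)
open import Function using (_∘_; _↔_; Inverse)
open import Function.Construct.Composition using (_↔-∘_)
open import Function.Construct.Identity using (↔-id)
open import Relation.Binary using (Tri; tri<; tri≈; tri>)
open import Relation.Binary.PropositionalEquality using (_≡_; _≢_; refl; sym; trans; cong; cong₂; subst; subst₂; module ≡-Reasoning)
open import Relation.Nullary using (¬_; Dec; yes; no)
open import Relation.Nullary.Decidable using (⌊_⌋; ¬?; decidable-stable)
open import Relation.Unary using (Decidable)

-- The upper end of the interval in which a line meets the polytope is never computed. It is enough
-- to have an integer `b` such that the polytope has a point on the line at a height in `[b, b + 1)`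
-- and no integral point above `b`. The highest enumerated integral point on the line provides one;
-- on a line without integral points, the floor of any rational point does. The points gained then
-- sit at heights `b + 1, ..., b + t`.
--
-- A rational point is kept as an integral vector with a positive multiplier, so the geometry
-- reduces to ring identities and integer inequalities; `ℚ` enters only when the result is
-- translated back.
--
-- The recursion must decide whether the next generator is torsion modulo `B`, which an arbitrary
-- predicate `B` does not allow. It therefore carries `Alternative`, a decision of linear dependence
-- modulo `B`: Gaussian elimination supplies it for `B` zero, and it survives dividing out a
-- nontorsion generator.

module Zonotope where
  open import Data.Integer using (_+_; _-_; _*_; -_; _≤_; _/ℕ_) renaming (∣_∣ to abs)

  -- Adding one generator to a polytope

  Pt : Set → Set
  Pt I = I → ℤ

  -- The result `w` is given only up to pointwise equality. This stands in for function
  -- extensionality: each use supplies one ring identity per coordinate.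
  record Submodule {I : Set} (B : Pt I → Set) : Set where
    field
      null : ∀ {w} → (∀ s → w s ≡ 0ℤ) → B w
      lin  : ∀ {x y w} p q → B x → B y → (∀ s → w s ≡ p * x s + q * y s) → B w

    scale : ∀ {x w} p → B x → (∀ s → w s ≡ p * x s) → B w
    scale {x} p bx eq = lin p 0ℤ bx bx λ s → trans (eq s) (lem p (x s))
      where
      lem : ∀ p x → p * x ≡ p * x + 0ℤ * x
      lem = solve-∀

    resp : ∀ {x w} → B x → (∀ s → w s ≡ x s) → B w
    resp bx eq = scale 1ℤ bx λ s → trans (eq s) (sym (ℤ.*-identityˡ _))

  open Submodule

  -- A complete irredundant system of representatives of `Q` modulo `B`, so that quotients are
  -- counted without being formed. Both the lattice count (`B` zero) and the torsion order have this
  -- shape.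
  Enum : {I : Set} → (Pt I → Set) → (Pt I → Set) → Set → Set
  Enum {I} B Q A = Σ[ f ∈ (A → Pt I) ]
    ((∀ i → Q (f i)) ×
     (∀ i j → B (λ s → f i s - f j s) → i ≡ j) ×
     (∀ x → Q x → ∃[ i ] B (λ s → x s - f i s)))

  Enum-reindex : ∀ {I A A′} {B Q : Pt I → Set} → A′ ↔ A → Enum B Q A → Enum B Q A′
  Enum-reindex {I} {B = B} φ (f , mem , inj , cov) =
      f ∘ to
    , (λ i → mem (to i))
    , (λ i j b → trans (sym (strictlyInverseʳ i)) (trans (cong from (inj _ _ b)) (strictlyInverseʳ j)))
    , λ x q → let (i , b) = cov x q in
        from i , subst (λ k → B (λ s → x s - f k s)) (sym (strictlyInverseˡ i)) b
    where
    open Inverse φ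

  Enum-⇔ : ∀ {I A} {B B′ Q Q′ : Pt I → Set} →
    (∀ x → B x → B′ x) → (∀ x → B′ x → B x) → (∀ x → Q x → Q′ x) → (∀ x → Q′ x → Q x) →
    Enum B Q A → Enum B′ Q′ A
  Enum-⇔ BB′ B′B QQ′ Q′Q (f , mem , inj , cov) =
      f
    , (λ i → QQ′ _ (mem i))
    , (λ i j b → inj i j (B′B _ b))
    , λ x q → let (i , b) = cov x (Q′Q x q) in i , BB′ _ b

  -- Integer inequalities

  0≤+ : ∀ {a b} → 0ℤ ≤ a → 0ℤ ≤ b → 0ℤ ≤ a + b
  0≤+ = ℤ.+-mono-≤

  0≤* : ∀ {a b} → 0ℤ ≤ a → 0ℤ ≤ b → 0ℤ ≤ a * b
  0≤* {+ a} {+ b} _ _ = subst (0ℤ ≤_) (ℤ.pos-* a b) (+≤+ ℕ.z≤n)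

  -- Keeping every bound in the form `0 ≤ a` turns an estimate into a sum of products of known
  -- bounds followed by one ring identity.
  0≤-resp : ∀ {a b} → 0ℤ ≤ a → a ≡ b → 0ℤ ≤ b
  0≤-resp p refl = p

  record Pos (k : ℤ) : Set where
    constructor 0≤k-1⇒Pos
    field
      0≤k-1 : 0ℤ ≤ k - 1ℤ

  Pos⇒0≤ : ∀ {k} → Pos k → 0ℤ ≤ k
  Pos⇒0≤ (0≤k-1⇒Pos p) = ℤ.≤-trans (+≤+ ℕ.z≤n) (0≤i-j⇒j≤i p)

  Pos-* : ∀ {k l} → Pos k → Pos l → Pos (k * l)
  Pos-* {k} {l} (0≤k-1⇒Pos p) posl@(0≤k-1⇒Pos q) = 0≤k-1⇒Pos (0≤-resp (0≤+ (0≤* p (Pos⇒0≤ posl)) q) (lem k l))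
    where
    lem : ∀ k l → (k - 1ℤ) * l + (l - 1ℤ) ≡ k * l - 1ℤ
    lem = solve-∀

  Pos-+ : ∀ {k l} → 0ℤ ≤ k → Pos l → Pos (k + l)
  Pos-+ {k} {l} p (0≤k-1⇒Pos q) = 0≤k-1⇒Pos (0≤-resp (0≤+ p q) (sym (ℤ.+-assoc k l (- 1ℤ))))

  Pos-resp : ∀ {k l} → Pos k → k ≡ l → Pos l
  Pos-resp p refl = p

  0≤+ℕ : ∀ {n} → 0ℤ ≤ + n
  0≤+ℕ = +≤+ ℕ.z≤n

  0≰-1 : ¬ (0ℤ ≤ - 1ℤ)
  0≰-1 ()

  -- Over the integers `0 ≤ - 1 - a` is the negation of `0 ≤ a`, again in the form of a bound from
  -- zero.
  ¬both : ∀ {a} → 0ℤ ≤ a → ¬ (0ℤ ≤ - 1ℤ - a)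
  ¬both {a} p q = 0≰-1 (0≤-resp (0≤+ p q) (lem a))
    where
    lem : ∀ a → a + (- 1ℤ - a) ≡ - 1ℤ
    lem = solve-∀

  0≤-or : ∀ a → (0ℤ ≤ a) ⊎ (0ℤ ≤ - 1ℤ - a)
  0≤-or (+ n) = inj₁ 0≤+ℕ
  0≤-or (-[1+ n ]) = inj₂ (0≤-resp (0≤+ℕ {n}) (lem n))
    where
    lem : ∀ n → + n ≡ - 1ℤ - -[1+ n ]
    lem zero = refl
    lem (suc n) = refl

  argmax : ∀ {N} {Q : Fin N → Set} → Decidable Q → (z : Fin N → ℤ) →
    (∀ j → ¬ Q j) ⊎ (∃[ j ] (Q j × (∀ l → Q l → z l ≤ z j)))
  argmax {zero} Q? z = inj₁ λ ()
  argmax {suc N} {Q} Q? z with argmax (Q? ∘ suc) (z ∘ suc) | Q? zero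
  ... | inj₁ none | no ¬q = inj₁ λ { zero → ¬q ; (suc j) → none j }
  ... | inj₁ none | yes q = inj₂ (zero , q , λ { zero _ → ℤ.≤-refl ; (suc l) ql → ⊥-elim (none l ql) })
  ... | inj₂ (j , qj , mx) | no ¬q = inj₂ (suc j , qj , λ { zero q → ⊥-elim (¬q q) ; (suc l) ql → mx l ql })
  ... | inj₂ (j , qj , mx) | yes q with ℤ.≤-total (z zero) (z (suc j))
  ...   | inj₁ le = inj₂ (suc j , qj , λ { zero _ → le ; (suc l) ql → mx l ql })
  ...   | inj₂ ge = inj₂ (zero , q , λ { zero _ → ℤ.≤-refl ; (suc l) ql → ℤ.≤-trans (mx l ql) ge })

  -- A rational polytope: K k y stands for "y / k lies in the polytope".
  Family : Set → Set₁
  Family I = ℤ → Pt I → Set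

  Mod : {I : Set} → Pt I → (Pt I → Set) → Pt I → Set
  Mod v B y = Σ[ c ∈ ℤ ] B (λ s → y s - c * v s)

  -- The polytope plus the whole line `ℚ v`: the displacement of `y / k` is `e / k`. This is what
  -- the polytope becomes after dividing out `v`.
  Along : {I : Set} → Pt I → Family I → Family I
  Along v K k y = Σ[ e ∈ ℤ ] K k (λ s → y s - e * v s)

  AddSegment : {I : Set} → ℕ → Pt I → Family I → Family I
  AddSegment t v K k y = Σ[ e ∈ ℤ ] (0ℤ ≤ e × 0ℤ ≤ k * + t - e × K k (λ s → y s - e * v s))

  -- The multiplier `k` places the test in `G ⊗ ℚ`: when `K` is invariant under `B`, torsion modulo
  -- `B` is invisible to it.
  In : {I : Set} → (Pt I → Set) → Family I → Pt I → Set
  In P K x = P x × (Σ[ k ∈ ℤ ] (Pos k × K k (λ s → k * x s)))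

  -- Ring identities for the one-generator step

  private
    ≡-lincomb-zero : ∀ p x → p * x ≡ p * x + 0ℤ * x
    ≡-lincomb-zero = solve-∀

    ≡-sub-zero : ∀ a b → a - 0ℤ * b ≡ a
    ≡-sub-zero = solve-∀

    ≡-torsion-eq : ∀ q k x e v → q * k * x ≡ q * (k * x - e * v) + e * (q * v)
    ≡-torsion-eq = solve-∀

    ≡-between-eq : ∀ f e k l x v → (f * k + e * l) * x ≡ f * (k * x - e * v) + e * (l * x + f * v)
    ≡-between-eq = solve-∀

    ≡-add-sub-zero : ∀ a b → a ≡ a - 0ℤ * b
    ≡-add-sub-zero = solve-∀

    ≡-neg-one-sub : ∀ e → - 1ℤ - (e - 1ℤ) ≡ 0ℤ - e
    ≡-neg-one-sub = solve-∀

    ≡-sub-neg : ∀ a e v → a + (- e) * v ≡ a - e * v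
    ≡-sub-neg = solve-∀

    ≡-floor-upper : ∀ k q e → (1ℤ + q) * k - (1ℤ + e) ≡ k * (1ℤ + q) - e - 1ℤ
    ≡-floor-upper = solve-∀

    ≡-level-point : ∀ k f z v h → k * f + k * z * v ≡ k * h + (- k) * (h - f - z * v)
    ≡-level-point = solve-∀

    ≡-level-upper : ∀ k z → k ≡ k * (1ℤ + z) - k * z
    ≡-level-upper = solve-∀

    ≡-maximal-class : ∀ h f z′ v g z → f - g - (z - z′) * v ≡ (- 1ℤ) * (h - f - z′ * v) + (- 1ℤ) * ((g + z * v) - h)
    ≡-maximal-class = solve-∀

    ≡-maximal-height : ∀ h f z′ v z → (z - z′) * v ≡ 1ℤ * (h - f - z′ * v) + 1ℤ * ((f + z * v) - h)
    ≡-maximal-height = solve-∀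

    ≡-new-lower : ∀ k b e j → (k * (1ℤ + b) - e) + k * j ≡ k * (b + (1ℤ + j)) - e
    ≡-new-lower = solve-∀

    ≡-new-upper : ∀ k b e j t → (e - k * b) + k * (t - (1ℤ + j)) ≡ k * t - (k * (b + (1ℤ + j)) - e)
    ≡-new-upper = solve-∀

    ≡-new-point : ∀ k f h e v → k * (f + h * v) - (k * h - e) * v ≡ k * f + e * v
    ≡-new-point = solve-∀

    ≡-line-class : ∀ f g z z′ v → f - g - (z′ - z) * v ≡ (f + z * v) - (g + z′ * v)
    ≡-line-class = solve-∀

    ≡-line-height : ∀ f z z′ v → (z - z′) * v ≡ (f + z * v) - (f + z′ * v)
    ≡-line-height = solve-∀

    ≡-old-shift : ∀ k x y → k * x ≡ k * y + k * (x - y)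
    ≡-old-shift = solve-∀

    ≡-new-height : ∀ b j → b - (b + (1ℤ + j)) ≡ - 1ℤ - j
    ≡-new-height = solve-∀

    ≡-sub-swap : ∀ x y → x - y ≡ (- 1ℤ) * (y - x)
    ≡-sub-swap = solve-∀

    ≡-old-lower : ∀ l b e z → (e - l * b) + l * (b - z) ≡ e - l * z
    ≡-old-lower = solve-∀

    ≡-old-point : ∀ l x e z v f → l * x + (e - l * z) * v ≡ (l * f + e * v) + l * (x - f - z * v)
    ≡-old-point = solve-∀

    ≡-past-lower : ∀ k b e z t → (k * (1ℤ + b) - e) + k * (- 1ℤ - (t - (1ℤ + (- 1ℤ - (b - z))))) ≡ k * (z - t) - e
    ≡-past-lower = solve-∀

    ≡-past-point : ∀ k x f z v t e → k * (f + (z - t) * v) + (k * t - e) * v ≡ (k * x - e * v) + (- k) * (x - f - z * v)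
    ≡-past-point = solve-∀

    ≡-past-height : ∀ t b z → - 1ℤ - (t - (1ℤ + (- 1ℤ - (b - z)))) ≡ - 1ℤ - (b - (z - t))
    ≡-past-height = solve-∀

    ≡-cov-point : ∀ x f z v → x - (f + z * v) ≡ x - f - z * v
    ≡-cov-point = solve-∀

    ≡-cov-height : ∀ b z → b + (1ℤ + (- 1ℤ - (b - z))) ≡ z
    ≡-cov-height = solve-∀

  -- The homogenised polytope: convexity becomes closure under nonnegative combinations of pairs
  -- `(k, y)`. Together with invariance under `B` this is all that the counting step uses about a
  -- zonotope.
  record Cone {I : Set} (B : Pt I → Set) (K : Family I) : Set where
    field
      comb : ∀ {k l j x y w} p q → 0ℤ ≤ p → 0ℤ ≤ q → K k x → K l y →
             j ≡ p * k + q * l → (∀ s → w s ≡ p * x s + q * y s) → K j w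
      shift : ∀ {k x b w} → K k x → ∀ p → B b → (∀ s → w s ≡ x s + p * b s) → K k w

    mult : ∀ {k x w} p → 0ℤ ≤ p → K k x → (∀ s → w s ≡ p * x s) → K (p * k) w
    mult {k} {x} p 0≤p kx eq = comb p 0ℤ 0≤p ℤ.≤-refl kx kx (≡-lincomb-zero p k) λ s → trans (eq s) (≡-lincomb-zero p (x s))

    transport : ∀ {k x w} → K k x → (∀ s → w s ≡ x s) → K k w
    transport {k} {x} kx eq = subst (λ k → K k _) (ℤ.*-identityˡ k)
      (mult 1ℤ (+≤+ ℕ.z≤n) kx λ s → trans (eq s) (sym (ℤ.*-identityˡ (x s))))

  Nontorsion : {I : Set} → (Pt I → Set) → Pt I → Set
  Nontorsion B v = ∀ c → B (λ s → c * v s) → c ≡ 0ℤ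

  module _ {I : Set} {B P : Pt I → Set} (Bm : Submodule B) (Pm : Submodule P)
           (v : Pt I) (Pv : P v) (t : ℕ) {K : Family I} (Kc : Cone B K) where

    open Cone Kc

    In⇒AddSegment : ∀ x → In P K x → In P (AddSegment t v K) x
    In⇒AddSegment x (px , k , pos , kx) =
      px , k , pos , 0ℤ , ℤ.≤-refl , 0≤-resp (0≤* (Pos⇒0≤ pos) (0≤+ℕ {t})) (sym (ℤ.+-identityʳ _))
      , transport kx λ s → ≡-sub-zero (k * x s) (v s)

    -- Multiplying a membership witness by `q` turns the displacement `e v` into `e (q v)`, an
    -- element of `B`, so a torsion segment adds no points.
    Enum-torsion : ∀ {A} q → Pos q → B (λ s → q * v s) →
      Enum B (In P K) A → Enum B (In P (AddSegment t v K)) A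
    Enum-torsion q posq bqv = Enum-⇔ {B = B} {B′ = B} (λ _ b → b) (λ _ b → b) In⇒AddSegment back
      where
      back : ∀ x → In P (AddSegment t v K) x → In P K x
      back x (px , k , pos , e , _ , _ , kx) = px , q * k , Pos-* posq pos ,
        shift (mult q (Pos⇒0≤ posq) kx (λ s → refl)) e bqv (λ s → ≡-torsion-eq q k (x s) e (v s))

    -- Convexity on the line through x - (e/k) v and x + (f/l) v.
    between : ∀ {k l} e f (x : Pt I) → 0ℤ ≤ e → 0ℤ ≤ f → Pos k → Pos l →
      K k (λ s → k * x s - e * v s) → K l (λ s → l * x s + f * v s) →
      Σ[ j ∈ ℤ ] (Pos j × K j (λ s → j * x s))
    -- Weights `f` and `e` cancel the two displacements, but the resulting multiplier `f k + e l` is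
    -- certainly positive only for `e ≥ 1`. For `e = 0` the first point is already `x`.
    between {k} {l} e f x 0≤e 0≤f posk posl kx lx with 0≤-or (e - 1ℤ)
    ... | inj₁ 1≤e = f * k + e * l , Pos-+ (0≤* 0≤f (Pos⇒0≤ posk)) (Pos-* {e} (0≤k-1⇒Pos 1≤e) posl) ,
        comb f e 0≤f 0≤e kx lx refl λ s → ≡-between-eq f e k l (x s) (v s)
    ... | inj₂ e≤0 = k , posk , transport kx λ s →
        trans (≡-add-sub-zero (k * x s) (v s)) (cong (λ e → k * x s - e * v s) 0≡e)
      where
      0≡e : 0ℤ ≡ e
      0≡e = ℤ.≤-antisym 0≤e (0≤i-j⇒j≤i (0≤-resp e≤0 (≡-neg-one-sub e)))

    -- Integral points gained on each line

    module _ (nt : Nontorsion B v) {N₁ N₂ : ℕ}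
             (f₁ : Fin N₁ → Pt I) (mem₁ : ∀ i → In P (Along v K) (f₁ i))
             (f₁-inj : ∀ i j → Mod v B (λ s → f₁ i s - f₁ j s) → i ≡ j)
             (cov₁ : ∀ x → In P (Along v K) x → ∃[ i ] Mod v B (λ s → x s - f₁ i s))
             (f₂ : Fin N₂ → Pt I) (mem₂ : ∀ i → In P K (f₂ i))
             (f₂-inj : ∀ i j → B (λ s → f₂ i s - f₂ j s) → i ≡ j)
             (cov₂ : ∀ x → In P K x → ∃[ i ] B (λ s → x s - f₂ i s)) where
      private
        In⇒Along : ∀ x → In P K x → In P (Along v K) x
        In⇒Along x i = let (px , k , pos , e , _ , _ , kx) = In⇒AddSegment x i in px , k , pos , e , kx

        class : ∀ j → ∃[ i ] Mod v B (λ s → f₂ j s - f₁ i s)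
        class j = cov₁ (f₂ j) (In⇒Along (f₂ j) (mem₂ j))

        -- Modulo `B`, the point `f₂ j` is `f₁ (g j) + height j · v`: `g` names its line and
        -- `height` its position there.
        g : Fin N₂ → Fin N₁
        g j = proj₁ (class j)

        height : Fin N₂ → ℤ
        height j = proj₁ (proj₂ (class j))

        at : Fin N₁ → ℤ → Pt I
        at i z s = f₁ i s + z * v s

        P-at : ∀ i z → P (at i z)
        P-at i z = lin Pm 1ℤ z (proj₁ (mem₁ i)) Pv λ s → cong (_+ z * v s) (sym (ℤ.*-identityˡ (f₁ i s)))

        nt-diff : ∀ z z′ → B (λ s → (z - z′) * v s) → z ≡ z′
        nt-diff z z′ b = i-j≡0⇒i≡j z z′ (nt _ b)

        -- The line over the i-th class meets the polytope in at i (e/k) with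
        -- b ≤ e/k < b + 1, and in no integral point above b.
        record Level (i : Fin N₁) : Set where
          field
            b k e : ℤ
            pos   : Pos k
            lower : 0ℤ ≤ e - k * b
            upper : Pos (k * (1ℤ + b) - e)
            point : K k (λ s → k * f₁ i s + e * v s)
            top   : ∀ j → g j ≡ i → height j ≤ b

        -- The known point is at height `- e / k`. With no integral point on the line, its floor
        -- serves as `b` and `top` holds vacuously.
        floor-level : ∀ i k e → Pos k → K k (λ s → k * f₁ i s - e * v s) → (∀ j → ¬ g j ≡ i) → Level i
        floor-level i k@(+ suc n) e pos ke none = record
          { b = q ; k = k ; e = - e ; pos = pos
          ; lower = i≤j⇒0≤j-i (subst (_≤ - e) (ℤ.*-comm q k) ([n/ℕd]*d≤n (- e) (suc n)))
          ; upper = 0≤k-1⇒Pos (0≤-resp (i≤j⇒0≤j-i (ℤ.i<j⇒suc[i]≤j (n<s[n/ℕd]*d (- e) (suc n)))) (≡-floor-upper k q (- e)))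
          ; point = transport ke (λ s → ≡-sub-neg (k * f₁ i s) e (v s))
          ; top = λ j eq → ⊥-elim (none j eq) }
          where
          q = (- e) /ℕ suc n
        floor-level i (+ zero) e (0≤k-1⇒Pos ()) ke none
        floor-level i -[1+ n ] e (0≤k-1⇒Pos ()) ke none

        -- The highest integral point is itself the required polytope point, with `e / k` equal to
        -- `b`; invariance under `B` moves it from `f₂ j` to its representative on the line.
        peak-level : ∀ j → (∀ l → g l ≡ g j → height l ≤ height j) → Level (g j)
        peak-level j mx = record
          { b = z ; k = k ; e = k * z ; pos = pos
          ; lower = ℤ.≤-reflexive (sym (ℤ.+-inverseʳ (k * z)))
          ; upper = Pos-resp pos (≡-level-upper k z)
          ; point = shift (proj₂ (proj₂ (proj₂ (mem₂ j)))) (- k) (proj₂ (proj₂ (class j)))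
                      (λ s → ≡-level-point k (f₁ (g j) s) z (v s) (f₂ j s))
          ; top = mx }
          where
          z = height j
          k = proj₁ (proj₂ (mem₂ j))
          pos = proj₁ (proj₂ (proj₂ (mem₂ j)))

        -- Only the fields of `Level` matter from here on, not which of the two constructions
        -- supplied them.
        abstract
          level : ∀ i → Level i
          level i = choose (argmax (λ j → g j Fin.≟ i) height)
            where
            choose : (∀ j → ¬ g j ≡ i) ⊎ (∃[ j ] (g j ≡ i × (∀ l → g l ≡ i → height l ≤ height j))) → Level i
            choose (inj₁ none) = let (_ , k , pos , e , ke) = mem₁ i in floor-level i k e pos ke none
            choose (inj₂ (j , refl , mx)) = peak-level j mx

        module L i = Level (level i)

        -- An integral point of the polytope is congruent to some `f₂ j`. Distinctness of the
        -- classes puts `f₂ j` on line `i`, nontorsion forces equal heights, and `top` bounds that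
        -- height.
        maximal : ∀ i z → Σ[ k ∈ ℤ ] (Pos k × K k (λ s → k * at i z s)) → z ≤ L.b i
        maximal i z kx = subst (_≤ L.b i) (sym z≡) (L.top i j gj≡i)
          where
          found = cov₂ (at i z) (P-at i z , kx)
          j = proj₁ found
          bj = proj₂ found
          bc = proj₂ (proj₂ (class j))
          gj≡i : g j ≡ i
          gj≡i = f₁-inj (g j) i (z - height j , lin Bm (- 1ℤ) (- 1ℤ) bc bj
                   λ s → ≡-maximal-class (f₂ j s) (f₁ (g j) s) (height j) (v s) (f₁ i s) z)
          z≡ : z ≡ height j
          z≡ = nt-diff z (height j) (lin Bm 1ℤ 1ℤ bc
                 (subst (λ i → B (λ s → (f₁ i s + z * v s) - f₂ j s)) (sym gj≡i) bj)
                 λ s → ≡-maximal-height (f₂ j s) (f₁ (g j) s) (height j) (v s) z)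

        -- The integral points gained over the i-th class are the t ones just above b.
        newHeight : Fin t → Fin N₁ → ℤ
        newHeight j i = L.b i + (1ℤ + + toℕ j)

        new : Fin t × Fin N₁ → Pt I
        new (j , i) = at i (newHeight j i)

        -- Seen from a height in `[b, b + 1)`, the heights `b + 1, ..., b + t` are at distance more
        -- than `0` and at most `t`.
        new-In : ∀ ji → In P (AddSegment t v K) (new ji)
        new-In (j , i) = P-at i (newHeight j i) , k , L.pos i , k * newHeight j i - e ,
            0≤-resp (0≤+ (Pos⇒0≤ (L.upper i)) (0≤* (Pos⇒0≤ (L.pos i)) (0≤+ℕ {toℕ j}))) (≡-new-lower k b e (+ toℕ j))
          , 0≤-resp (0≤+ (L.lower i) (0≤* (Pos⇒0≤ (L.pos i)) (i≤j⇒0≤j-i (+≤+ (toℕ<n j))))) (≡-new-upper k b e (+ toℕ j) (+ t))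
          , transport (L.point i) λ s → ≡-new-point k (f₁ i s) (newHeight j i) e (v s)
          where
          k = L.k i
          b = L.b i
          e = L.e i

        same-line : ∀ i i′ z z′ → B (λ s → at i z s - at i′ z′ s) → i ≡ i′ × z ≡ z′
        same-line i i′ z z′ b = i≡i′ , nt-diff z z′ (resp Bm
            (subst (λ i → B (λ s → at i z s - at i′ z′ s)) i≡i′ b)
            λ s → ≡-line-height (f₁ i′ s) z z′ (v s))
          where
          i≡i′ : i ≡ i′
          i≡i′ = f₁-inj i i′ (z′ - z , resp Bm b λ s → ≡-line-class (f₁ i s) (f₁ i′ s) z z′ (v s))

        new≉old : ∀ ji l → ¬ B (λ s → new ji s - f₂ l s)
        new≉old (j , i) l b = ¬both (0≤+ℕ {toℕ j}) (0≤-resp (i≤j⇒0≤j-i h≤b) (≡-new-height (L.b i) (+ toℕ j)))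
          where
          k = proj₁ (proj₂ (mem₂ l))
          h≤b : newHeight j i ≤ L.b i
          h≤b = maximal i (newHeight j i) (k , proj₁ (proj₂ (proj₂ (mem₂ l))) ,
                  shift (proj₂ (proj₂ (proj₂ (mem₂ l)))) k b λ s → ≡-old-shift k (new (j , i) s) (f₂ l s))

        points : (Fin t × Fin N₁) ⊎ Fin N₂ → Pt I
        points (inj₁ ji) = new ji
        points (inj₂ l) = f₂ l

        points-In : ∀ a → In P (AddSegment t v K) (points a)
        points-In (inj₁ ji) = new-In ji
        points-In (inj₂ l) = In⇒AddSegment (f₂ l) (mem₂ l)

        points-inj : ∀ a a′ → B (λ s → points a s - points a′ s) → a ≡ a′
        points-inj (inj₁ (j , i)) (inj₁ (j′ , i′)) b = both (same-line i i′ (newHeight j i) (newHeight j′ i′) b)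
          where
          both : i ≡ i′ × newHeight j i ≡ newHeight j′ i′ → inj₁ (j , i) ≡ inj₁ (j′ , i′)
          both (refl , h) = cong (λ j → inj₁ (j , i)) (toℕ-injective (ℤ.+-injective
            (ℤ+.∙-cancelˡ 1ℤ (+ toℕ j) (+ toℕ j′) (ℤ+.∙-cancelˡ (L.b i) _ _ h))))
        points-inj (inj₁ ji) (inj₂ l) b = ⊥-elim (new≉old ji l b)
        points-inj (inj₂ l) (inj₁ ji) b = ⊥-elim (new≉old ji l
          (scale Bm (- 1ℤ) b λ s → ≡-sub-swap (new ji s) (f₂ l s)))
        points-inj (inj₂ l) (inj₂ l′) b = cong inj₂ (f₂-inj l l′ b)

        module Cover (x : Pt I) (px : P x) (k : ℤ) (posk : Pos k) (e : ℤ) (0≤e : 0ℤ ≤ e)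
                     (e≤kt : 0ℤ ≤ k * + t - e) (kx : K k (λ s → k * x s - e * v s))
                     (i : Fin N₁) (z : ℤ) (bz : B (λ s → x s - f₁ i s - z * v s)) where
          l = L.k i

          -- At height `z ≤ b` the point `x` lies between its foot `x - (e / k) v` and the level
          -- point, both in the polytope.
          old : 0ℤ ≤ L.b i - z → ∃[ j ] B (λ s → x s - f₂ j s)
          old z≤b = cov₂ x (px , between {k} {l} e (L.e i - l * z) x 0≤e
            (0≤-resp (0≤+ (L.lower i) (0≤* (Pos⇒0≤ (L.pos i)) z≤b)) (≡-old-lower l (L.b i) (L.e i) z))
            posk (L.pos i) kx
            (shift (L.point i) l bz λ s → ≡-old-point l (x s) (L.e i) z (v s) (f₁ i s)))

          -- `c = z - b - 1` is the index of `x` among the new points, provided that it lies in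
          -- `0, ..., t - 1`.
          c : ℤ
          c = - 1ℤ - (L.b i - z)

          -- If `c ≥ t`, then `z - t` is at least `b + 1`, hence above the level point, and at most
          -- the height `z - e / k` of the foot. Convexity makes it an integral point of the
          -- polytope above `b`.
          not-past : ¬ (0ℤ ≤ - 1ℤ - (+ t - (1ℤ + c)))
          not-past past = ¬both (i≤j⇒0≤j-i (maximal i (z - + t) inside)) (0≤-resp past (≡-past-height (+ t) (L.b i) z))
            where
            inside : Σ[ j ∈ ℤ ] (Pos j × K j (λ s → j * at i (z - + t) s))
            inside = between {l} {k} (l * (z - + t) - L.e i) (k * + t - e) (at i (z - + t))
              (0≤-resp (0≤+ (Pos⇒0≤ (L.upper i)) (0≤* (Pos⇒0≤ (L.pos i)) past)) (≡-past-lower l (L.b i) (L.e i) z (+ t)))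
              e≤kt (L.pos i) posk
              (transport (L.point i) λ s → ≡-new-point l (f₁ i s) (z - + t) (L.e i) (v s))
              (shift kx (- k) bz λ s → ≡-past-point k (x s) (f₁ i s) z (v s) (+ t) e)

          found-new : 0ℤ ≤ c → 0ℤ ≤ + t - (1ℤ + c) → ∃[ j ] B (λ s → x s - new (j , i) s)
          found-new 0≤c c<t = j , resp Bm bz λ s →
              trans (cong (λ h → x s - (f₁ i s + h * v s)) h≡z) (≡-cov-point (x s) (f₁ i s) z (v s))
            where
            ∣c∣ : + abs c ≡ c
            ∣c∣ = ℤ.0≤i⇒+∣i∣≡i 0≤c
            ∣c∣<t : abs c ℕ.< t
            ∣c∣<t = ℤ.drop‿+≤+ (0≤i-j⇒j≤i {+ t} {1ℤ + + abs c} (subst (λ c → 0ℤ ≤ + t - (1ℤ + c)) (sym ∣c∣) c<t))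
            j = fromℕ< ∣c∣<t
            h≡z : newHeight j i ≡ z
            h≡z = trans (cong (λ n → L.b i + (1ℤ + + n)) (toℕ-fromℕ< ∣c∣<t))
                    (trans (cong (λ y → L.b i + (1ℤ + y)) ∣c∣) (≡-cov-height (L.b i) z))

          covered : ∃[ a ] B (λ s → x s - points a s)
          covered = decide (0≤-or (L.b i - z)) (0≤-or (+ t - (1ℤ + c)))
            where
            decide : (0ℤ ≤ L.b i - z) ⊎ (0ℤ ≤ c) → (0ℤ ≤ + t - (1ℤ + c)) ⊎ (0ℤ ≤ - 1ℤ - (+ t - (1ℤ + c))) →
              ∃[ a ] B (λ s → x s - points a s)
            decide (inj₁ z≤b) _ = let (j , b) = old z≤b in inj₂ j , b
            decide (inj₂ 0≤c) (inj₁ c<t) = let (j , b) = found-new 0≤c c<t in inj₁ (j , i) , b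
            decide (inj₂ _) (inj₂ past) = ⊥-elim (not-past past)

        points-cov : ∀ x → In P (AddSegment t v K) x → ∃[ a ] B (λ s → x s - points a s)
        points-cov x (px , k , posk , e , 0≤e , e≤kt , kx) =
          let (i , z , bz) = cov₁ x (px , k , posk , e , kx)
          in Cover.covered x px k posk e 0≤e e≤kt kx i z bz

      Enum-nontorsion′ : Enum B (In P (AddSegment t v K)) (Fin (t ℕ.* N₁ ℕ.+ N₂))
      Enum-nontorsion′ = Enum-reindex {B = B} {Q = In P (AddSegment t v K)} ((*↔× ⊎-↔ ↔-id (Fin N₂)) ↔-∘ +↔⊎)
        (points , points-In , points-inj , points-cov)

    Enum-nontorsion : Nontorsion B v → ∀ {N₁ N₂} →
      Enum (Mod v B) (In P (Along v K)) (Fin N₁) → Enum B (In P K) (Fin N₂) →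
      Enum B (In P (AddSegment t v K)) (Fin (t ℕ.* N₁ ℕ.+ N₂))
    Enum-nontorsion nt (f₁ , mem₁ , f₁-inj , cov₁) (f₂ , mem₂ , f₂-inj , cov₂) =
      Enum-nontorsion′ nt f₁ mem₁ f₁-inj cov₁ f₂ mem₂ f₂-inj cov₂

  -- The boundary operator

  sum-cong : ∀ {m} {f g : Fin m → ℤ} → (∀ i → f i ≡ g i) → sumFinℤ f ≡ sumFinℤ g
  sum-cong {zero} eq = refl
  sum-cong {suc m} eq = cong₂ _+_ (eq zero) (sum-cong (eq ∘ suc))

  sum-lin : ∀ {m} p q (f g : Fin m → ℤ) →
    sumFinℤ (λ i → p * f i + q * g i) ≡ p * sumFinℤ f + q * sumFinℤ g
  sum-lin {zero} p q f g = lem p q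
    where
    lem : ∀ p q → 0ℤ ≡ p * 0ℤ + q * 0ℤ
    lem = solve-∀
  sum-lin {suc m} p q f g = trans (cong (λ z → p * f zero + q * g zero + z) (sum-lin p q (f ∘ suc) (g ∘ suc)))
    (lem p q (f zero) (g zero) _ _)
    where
    lem : ∀ p q a b x y → p * a + q * b + (p * x + q * y) ≡ p * (a + x) + q * (b + y)
    lem = solve-∀

  sum-scale : ∀ {m} p (f : Fin m → ℤ) → sumFinℤ (λ i → p * f i) ≡ p * sumFinℤ f
  sum-scale {zero} p f = sym (ℤ.*-zeroʳ p)
  sum-scale {suc m} p f = trans (cong (λ z → p * f zero + z) (sum-scale p (f ∘ suc))) (sym (ℤ.*-distribˡ-+ p _ _))

  sum-zero : ∀ {m} {f : Fin m → ℤ} → (∀ i → f i ≡ 0ℤ) → sumFinℤ f ≡ 0ℤ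
  sum-zero {zero} eq = refl
  sum-zero {suc m} eq = cong₂ _+_ (eq zero) (sum-zero (eq ∘ suc))

  sum-+ : ∀ {m} (f g : Fin m → ℤ) → sumFinℤ (λ i → f i + g i) ≡ sumFinℤ f + sumFinℤ g
  sum-+ {zero} f g = refl
  sum-+ {suc m} f g = trans (cong (λ z → f zero + g zero + z) (sum-+ (f ∘ suc) (g ∘ suc))) (lem (f zero) (g zero) _ _)
    where
    lem : ∀ a b x y → a + b + (x + y) ≡ (a + x) + (b + y)
    lem = solve-∀

  sum-swap : ∀ {m n} (f : Fin m → Fin n → ℤ) →
    sumFinℤ (λ i → sumFinℤ (f i)) ≡ sumFinℤ (λ j → sumFinℤ (λ i → f i j))
  sum-swap {zero} {n} f = sym (sum-zero {n} {λ _ → 0ℤ} λ _ → refl)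
  sum-swap {suc m} f = trans (cong (λ z → sumFinℤ (f zero) + z) (sum-swap (f ∘ suc)))
    (sym (sum-+ (f zero) (λ j → sumFinℤ (λ i → f (suc i) j))))

  private
    variable
      A X : Set

  if-yes : (a? : Dec A) {x y : X} → A → (if ⌊ a? ⌋ then x else y) ≡ x
  if-yes (yes _) _ = refl
  if-yes (no ¬a) a = ⊥-elim (¬a a)

  if-no : (a? : Dec A) {x y : X} → ¬ A → (if ⌊ a? ⌋ then x else y) ≡ y
  if-no (yes a) ¬a = ⊥-elim (¬a a)
  if-no (no _) _ = refl

  -- Passing from the decision procedure to `lookup` makes sums over a subset compute by recursion
  -- on its vector.
  ∈?-lookup : ∀ {n} (τ : Subset n) v → ⌊ v ∈? τ ⌋ ≡ lookup τ v
  ∈?-lookup (true ∷ τ) zero = refl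
  ∈?-lookup (false ∷ τ) zero = refl
  ∈?-lookup (_ ∷ τ) (suc v) with v ∈? τ | ∈?-lookup τ v
  ... | yes _ | eq = eq
  ... | no _ | eq = eq

  sumℕ-cong : ∀ {m} {f g : Fin m → ℕ} → (∀ i → f i ≡ g i) → sumFinℕ f ≡ sumFinℕ g
  sumℕ-cong {zero} eq = refl
  sumℕ-cong {suc m} eq = cong₂ ℕ._+_ (eq zero) (sumℕ-cong (eq ∘ suc))

  count : ∀ {n} → (Fin n → Bool) → Subset n → ℕ
  count g τ = sumFinℕ (λ u → if lookup τ u ∧ g u then 1 else 0)

  -- The predicate is arbitrary because the induction replaces `g` by `g ∘ suc`; comparison with a
  -- fixed vertex is not stable under that shift.
  count-insert : ∀ {n} (g : Fin n → Bool) (τ : Subset n) v → v ∉ τ →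
    count g (τ ∪ ⁅ v ⁆) ≡ (if g v then 1 else 0) ℕ.+ count g τ
  count-insert g (true ∷ τ) zero v∉τ = ⊥-elim (v∉τ here)
  count-insert g (false ∷ τ) zero v∉τ rewrite ∪-identityʳ τ = refl
  count-insert g (true ∷ τ) (suc v) v∉τ rewrite count-insert (g ∘ suc) τ v (v∉τ ∘ there) =
    ℕ+.x∙yz≈y∙xz (if g zero then 1 else 0) (if g (suc v) then 1 else 0) (count (g ∘ suc) τ)
  count-insert g (false ∷ τ) (suc v) v∉τ = count-insert (g ∘ suc) τ v (v∉τ ∘ there)

  below-count : ∀ {n} (τ : Subset n) u → below τ u ≡ count (λ w → ⌊ w <? u ⌋) τ
  below-count τ u = sumℕ-cong λ w → cong (λ b → if b ∧ ⌊ w <? u ⌋ then 1 else 0) (∈?-lookup τ w)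

  below-insert : ∀ {n} (τ : Subset n) v u → v ∉ τ →
    below (τ ∪ ⁅ v ⁆) u ≡ (if ⌊ v <? u ⌋ then 1 else 0) ℕ.+ below τ u
  below-insert τ v u v∉τ = trans (below-count (τ ∪ ⁅ v ⁆) u) (trans (count-insert (λ w → ⌊ w <? u ⌋) τ v v∉τ)
    (cong (λ k → (if ⌊ v <? u ⌋ then 1 else 0) ℕ.+ k) (sym (below-count τ u))))

  card-insert : ∀ {n} (τ : Subset n) v → v ∉ τ → ∣ τ ∪ ⁅ v ⁆ ∣ ≡ suc ∣ τ ∣
  card-insert (true ∷ τ) zero v∉τ = ⊥-elim (v∉τ here)
  card-insert (false ∷ τ) zero v∉τ = cong (suc ∘ ∣_∣) (∪-identityʳ τ)
  card-insert (true ∷ τ) (suc v) v∉τ = cong suc (card-insert τ v (v∉τ ∘ there))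
  card-insert (false ∷ τ) (suc v) v∉τ = card-insert τ v (v∉τ ∘ there)

  bdTerm : ∀ {n} → Chain n → Subset n → Fin n → ℤ
  bdTerm c τ v = if ⌊ v ∈? τ ⌋ then 0ℤ else sgn (below τ v) * c (τ ∪ ⁅ v ⁆)

  module _ {n : ℕ} (c : Chain n) (τ : Subset n) where
    private
      F : Fin n → Fin n → ℤ
      F v u = if ⌊ v ∈? τ ⌋ then 0ℤ else
        sgn (below τ v) * (if ⌊ u ∈? (τ ∪ ⁅ v ⁆) ⌋ then 0ℤ else
          sgn (below (τ ∪ ⁅ v ⁆) u) * c ((τ ∪ ⁅ v ⁆) ∪ ⁅ u ⁆))

      F-left : ∀ {v u} → v ∈ τ → F v u ≡ 0ℤ
      F-left {v} v∈τ = if-yes (v ∈? τ) v∈τ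

      F-inner : ∀ {v u} → u ∈ τ ∪ ⁅ v ⁆ → F v u ≡ 0ℤ
      F-inner {v} {u} u∈ with v ∈? τ
      ... | yes _ = refl
      ... | no _ = trans (cong (sgn (below τ v) *_) (if-yes (u ∈? (τ ∪ ⁅ v ⁆)) u∈)) (ℤ.*-zeroʳ (sgn (below τ v)))

      F-outside : ∀ {v u} → v ∉ τ → u ∉ τ → u ≢ v →
        F v u ≡ sgn (below τ v) * (sgn ((if ⌊ v <? u ⌋ then 1 else 0) ℕ.+ below τ u) * c ((τ ∪ ⁅ v ⁆) ∪ ⁅ u ⁆))
      F-outside {v} {u} v∉τ u∉τ u≢v = trans (if-no (v ∈? τ) v∉τ) (cong (sgn (below τ v) *_)
        (trans (if-no (u ∈? (τ ∪ ⁅ v ⁆)) ([ u∉τ , u≢v ∘ x∈⁅y⁆⇒x≡y v ]′ ∘ x∈p∪q⁻ τ ⁅ v ⁆))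
               (cong (λ k → sgn k * c ((τ ∪ ⁅ v ⁆) ∪ ⁅ u ⁆)) (below-insert τ v u v∉τ))))

      ∪-swap : ∀ v u → (τ ∪ ⁅ v ⁆) ∪ ⁅ u ⁆ ≡ (τ ∪ ⁅ u ⁆) ∪ ⁅ v ⁆
      ∪-swap v u = trans (∪-assoc τ ⁅ v ⁆ ⁅ u ⁆)
        (trans (cong (τ ∪_) (∪-comm ⁅ v ⁆ ⁅ u ⁆)) (sym (∪-assoc τ ⁅ u ⁆ ⁅ v ⁆)))

      -- Inserting the smaller vertex first raises the position of the larger by one and flips its
      -- sign; inserting the larger first leaves the position of the smaller unchanged.
      F-< : ∀ {v u} → v ∉ τ → u ∉ τ → v < u → F v u ≡ - F u v
      F-< {v} {u} v∉τ u∉τ v<u = begin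
        F v u
          ≡⟨ F-outside v∉τ u∉τ (λ eq → Fin.<-irrefl (sym eq) v<u) ⟩
        a * (sgn ((if ⌊ v <? u ⌋ then 1 else 0) ℕ.+ below τ u) * c ((τ ∪ ⁅ v ⁆) ∪ ⁅ u ⁆))
          ≡⟨ cong₂ (λ k x → a * (sgn (k ℕ.+ below τ u) * c x)) (if-yes (v <? u) v<u) (∪-swap v u) ⟩
        a * (- b * c ((τ ∪ ⁅ u ⁆) ∪ ⁅ v ⁆))
          ≡⟨ lem a b (c ((τ ∪ ⁅ u ⁆) ∪ ⁅ v ⁆)) ⟩
        - (b * (a * c ((τ ∪ ⁅ u ⁆) ∪ ⁅ v ⁆)))
          ≡⟨ cong (λ k → - (b * (sgn (k ℕ.+ below τ v) * c ((τ ∪ ⁅ u ⁆) ∪ ⁅ v ⁆)))) (if-no (u <? v) (Fin.<-asym v<u)) ⟨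
        - (b * (sgn ((if ⌊ u <? v ⌋ then 1 else 0) ℕ.+ below τ v) * c ((τ ∪ ⁅ u ⁆) ∪ ⁅ v ⁆)))
          ≡⟨ cong -_ (F-outside u∉τ v∉τ (λ eq → Fin.<-irrefl eq v<u)) ⟨
        - F u v ∎
        where
        open ≡-Reasoning
        a = sgn (below τ v)
        b = sgn (below τ u)
        lem : ∀ a b c → a * (- b * c) ≡ - (b * (a * c))
        lem = solve-∀

      F-antisym : ∀ v u → F v u ≡ - F u v
      F-antisym v u = cases (v ∈? τ) (u ∈? τ) (Fin.<-cmp v u)
        where
        zeros : F v u ≡ 0ℤ → F u v ≡ 0ℤ → F v u ≡ - F u v
        zeros p q = trans p (cong -_ (sym q))
        cases : Dec (v ∈ τ) → Dec (u ∈ τ) → Tri (v < u) (v ≡ u) (u < v) → F v u ≡ - F u v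
        cases (yes v∈τ) _ _ = zeros (F-left v∈τ) (F-inner (x∈p∪q⁺ (inj₁ v∈τ)))
        cases (no _) (yes u∈τ) _ = zeros (F-inner (x∈p∪q⁺ (inj₁ u∈τ))) (F-left u∈τ)
        cases (no v∉τ) (no u∉τ) (tri< v<u _ _) = F-< v∉τ u∉τ v<u
        cases (no v∉τ) (no u∉τ) (tri> _ _ u<v) =
          trans (sym (ℤ.neg-involutive (F v u))) (cong -_ (sym (F-< u∉τ v∉τ u<v)))
        cases (no _) (no _) (tri≈ _ refl _) = zeros same same
          where same = F-inner (x∈p∪q⁺ (inj₂ (x∈⁅x⁆ v)))

      ΣF = sumFinℤ (λ v → sumFinℤ (F v))

      -- Antisymmetry combined with exchanging the two sums. Since `ℤ` has no 2-torsion, this makes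
      -- the double boundary vanish.
      ΣF≡-ΣF : ΣF ≡ - ΣF
      ΣF≡-ΣF = begin
        ΣF ≡⟨ sum-cong {n} (λ v → sum-cong {n} (λ u → trans (F-antisym v u) (neg (F u v)))) ⟩
        sumFinℤ (λ v → sumFinℤ (λ u → - 1ℤ * F u v)) ≡⟨ sum-cong {n} (λ v → sum-scale (- 1ℤ) (λ u → F u v)) ⟩
        sumFinℤ (λ v → - 1ℤ * sumFinℤ (λ u → F u v)) ≡⟨ sum-scale (- 1ℤ) (λ v → sumFinℤ (λ u → F u v)) ⟩
        - 1ℤ * sumFinℤ (λ v → sumFinℤ (λ u → F u v)) ≡⟨ neg (sumFinℤ (λ v → sumFinℤ (λ u → F u v))) ⟨
        - sumFinℤ (λ v → sumFinℤ (λ u → F u v)) ≡⟨ cong -_ (sum-swap F) ⟨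
        - ΣF ∎
        where
        open ≡-Reasoning
        neg : ∀ x → - x ≡ - 1ℤ * x
        neg = solve-∀

      ≡-⇒0 : ∀ x → x ≡ - x → x ≡ 0ℤ
      ≡-⇒0 (+ zero) _ = refl
      ≡-⇒0 (+ suc _) ()
      ≡-⇒0 -[1+ _ ] ()

      expand : ∀ v → bdTerm (bd c) τ v ≡ sumFinℤ (F v)
      expand v with v ∈? τ
      ... | yes _ = sym (sum-zero {n} {λ _ → 0ℤ} λ _ → refl)
      ... | no _ = sym (sum-scale (sgn (below τ v)) (bdTerm c (τ ∪ ⁅ v ⁆)))

    bd-bd : bd (bd c) τ ≡ 0ℤ
    bd-bd = trans (sum-cong {n} expand) (≡-⇒0 ΣF ΣF≡-ΣF)

  bd-lin : ∀ {n} p q (x y w : Chain n) → (∀ s → w s ≡ p * x s + q * y s) →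
    ∀ τ → bd w τ ≡ p * bd x τ + q * bd y τ
  bd-lin {n} p q x y w eq τ = trans (sum-cong {n} term) (sum-lin {n} p q (bdTerm x τ) (bdTerm y τ))
    where
    lem : ∀ p q a x y → a * (p * x + q * y) ≡ p * (a * x) + q * (a * y)
    lem = solve-∀
    lem₀ : ∀ p q → 0ℤ ≡ p * 0ℤ + q * 0ℤ
    lem₀ = solve-∀
    term : ∀ v → bdTerm w τ v ≡ p * bdTerm x τ v + q * bdTerm y τ v
    term v with v ∈? τ
    ... | yes _ = lem₀ p q
    ... | no _ = trans (cong (sgn (below τ v) *_) (eq (τ ∪ ⁅ v ⁆))) (lem p q (sgn (below τ v)) (x (τ ∪ ⁅ v ⁆)) (y (τ ∪ ⁅ v ⁆)))

  module _ {d n : ℕ} (H : Hypergraph d n) where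

    IsCycle-submodule : Submodule (IsCycle H)
    IsCycle-submodule = record
      { null = λ {w} w≡0 → (λ s _ → w≡0 s) ,
          λ τ → trans (bd-lin 0ℤ 0ℤ w w w (λ s → trans (w≡0 s) (lem₁ (w s))) τ) (sym (lem₁ (bd w τ)))
      ; lin = λ {x} {y} {w} p q (x₀ , ∂x) (y₀ , ∂y) eq →
          (λ s ≢d → trans (eq s) (trans (cong₂ (λ a b → p * a + q * b) (x₀ s ≢d) (y₀ s ≢d)) (lem p q))) ,
          λ τ → trans (bd-lin p q x y w eq τ) (trans (cong₂ (λ a b → p * a + q * b) (∂x τ) (∂y τ)) (lem p q))
      }
      where
      lem : ∀ p q → p * 0ℤ + q * 0ℤ ≡ 0ℤ
      lem = solve-∀
      lem₁ : ∀ x → 0ℤ ≡ 0ℤ * x + 0ℤ * x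
      lem₁ = solve-∀

    bdEdge-cycle : ∀ i → IsCycle H (bdEdge H i)
    bdEdge-cycle i = (λ s ∣s∣≢d → sum-zero {n} (vanish s ∣s∣≢d)) , bd-bd (δ (edge H i))
      where
      vanish : ∀ s → ∣ s ∣ ≢ d → ∀ v → bdTerm (δ (edge H i)) s v ≡ 0ℤ
      vanish s ∣s∣≢d v with v ∈? s
      ... | yes _ = refl
      ... | no v∉s = trans (cong (sgn (below s v) *_) (if-no ((s ∪ ⁅ v ⁆) ≟ₛ edge H i) λ eq →
              ∣s∣≢d (ℕ.suc-injective (trans (sym (card-insert s v v∉s)) (trans (cong ∣_∣ eq) (uniform H i))))))
              (ℤ.*-zeroʳ (sgn (below s v)))

  -- Counting lattice points of zonotopes

  module _ {I : Set} where

    combine : ∀ {m} → (Fin m → ℤ) → (Fin m → Pt I) → Pt I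
    combine a v s = sumFinℤ (λ i → a i * v i s)

    -- Written with `lookup` so that it reduces on `true ∷ S` and `false ∷ S`, the contraction and
    -- deletion cases.
    combineOn : ∀ {m} → Subset m → (Fin m → ℤ) → (Fin m → Pt I) → Pt I
    combineOn S a v s = sumFinℤ (λ i → if lookup S i then a i * v i s else 0ℤ)

    Zero : Pt I → Set
    Zero x = ∀ s → x s ≡ 0ℤ

    Poly : (Pt I → Set) → ℕ → ∀ {m} → (Fin m → Pt I) → Family I
    Poly B t {m} v k y = Σ[ a ∈ (Fin m → ℤ) ]
      ((∀ i → 0ℤ ≤ a i × 0ℤ ≤ k * + t - a i) × B (λ s → y s - combine a v s))

    -- A torsion element is an integral point of the zonotope without generators: some positive
    -- multiple lies in `B`.
    Tors : (Pt I → Set) → (Pt I → Set) → Pt I → Set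
    Tors P B = In P (λ _ → B)

    Span : (Pt I → Set) → ∀ {m} → (Fin m → Pt I) → Subset m → Pt I → Set
    Span B {m} v S y = Σ[ a ∈ (Fin m → ℤ) ] B (λ s → y s - combineOn S a v s)

    Indep : (Pt I → Set) → ∀ {m} → (Fin m → Pt I) → Subset m → Set
    Indep B {m} v S = ∀ (a : Fin m → ℤ) → B (combineOn S a v) → ∀ i → i ∈ S → a i ≡ 0ℤ

    -- All finite families are covered, not just single vectors, so that the property passes to a
    -- quotient: dependence modulo `Mod v B` is dependence modulo `B` of a family enlarged by `v`.
    Alternative : (Pt I → Set) → Set
    Alternative B = ∀ r (w : Fin r → Pt I) →
      (∀ a → B (combine a w) → ∀ i → a i ≡ 0ℤ) ⊎
      (Σ[ a ∈ (Fin r → ℤ) ] (B (combine a w) × ∃[ i ] a i ≢ 0ℤ))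

    combine-lin : ∀ {m} p q (a b : Fin m → ℤ) v s →
      combine (λ i → p * a i + q * b i) v s ≡ p * combine a v s + q * combine b v s
    combine-lin {m} p q a b v s = trans (sum-cong {m} (λ i → lem p q (a i) (b i) (v i s)))
      (sum-lin p q (λ i → a i * v i s) (λ i → b i * v i s))
      where
      lem : ∀ p q a b v → (p * a + q * b) * v ≡ p * (a * v) + q * (b * v)
      lem = solve-∀

    combine-zero : ∀ {m} {a : Fin m → ℤ} v → (∀ i → a i ≡ 0ℤ) → ∀ s → combine a v s ≡ 0ℤ
    combine-zero {m} v a≡0 s = sum-zero {m} λ i → cong (_* v i s) (a≡0 i)

    combineOn-zero : ∀ {m} (S : Subset m) {a : Fin m → ℤ} v → (∀ i → i ∈ S → a i ≡ 0ℤ) → ∀ s → combineOn S a v s ≡ 0ℤ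
    combineOn-zero [] v a≡0 s = refl
    combineOn-zero (true ∷ S) v a≡0 s = cong₂ _+_ (cong (_* v zero s) (a≡0 zero here))
      (combineOn-zero S (v ∘ suc) (λ i i∈S → a≡0 (suc i) (there i∈S)) s)
    combineOn-zero (false ∷ S) v a≡0 s = trans (ℤ.+-identityˡ _)
      (combineOn-zero S (v ∘ suc) (λ i i∈S → a≡0 (suc i) (there i∈S)) s)

  -- Ring identities for zonotopes and elimination

  private
    ≡-Poly-bound : ∀ p q k l t a b → p * (k * t - a) + q * (l * t - b) ≡ (p * k + q * l) * t - (p * a + q * b)
    ≡-Poly-bound = solve-∀

    ≡-Poly-lin : ∀ p q x y a b → p * x + q * y - (p * a + q * b) ≡ p * (x - a) + q * (y - b)
    ≡-Poly-lin = solve-∀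

    ≡-Poly-shift : ∀ x p b a → x + p * b - a ≡ 1ℤ * (x - a) + p * b
    ≡-Poly-shift = solve-∀

    ≡-Mod-lin : ∀ p q x y a b v → p * x + q * y - (p * a + q * b) * v ≡ p * (x - a * v) + q * (y - b * v)
    ≡-Mod-lin = solve-∀

    ≡-sub-sub : ∀ y a v c → y - (a * v + c) ≡ y - a * v - c
    ≡-sub-sub = solve-∀

    ≡-sub-comm : ∀ y a v c → y - c - a * v ≡ y - a * v - c
    ≡-sub-comm = solve-∀

    ≡-sub-sub′ : ∀ y a v c → y - (a * v + c) ≡ y - c - a * v
    ≡-sub-sub′ = solve-∀

    ≡-sub-neg′ : ∀ a v c → a * v + c ≡ c - (- a) * v
    ≡-sub-neg′ = solve-∀

    ≡-neg-add : ∀ a v c → - a * v + c ≡ c - a * v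
    ≡-neg-add = solve-∀

    ≡-add-zero : ∀ a v → a * v ≡ (a * v + 0ℤ)
    ≡-add-zero = solve-∀

    ≡-sub-zero′ : ∀ y → y - 0ℤ ≡ y
    ≡-sub-zero′ = solve-∀

    ≡-Gauss-term : ∀ a p x y c → a * (p * x - y * c) ≡ p * (a * x) + (- c) * (a * y)
    ≡-Gauss-term = solve-∀

    ≡-Gauss-dep : ∀ p A B c → - B * c + p * A ≡ p * A + (- c) * B
    ≡-Gauss-dep = solve-∀

    ≡-Gauss-indep : ∀ p A B a c → p * A + (- c) * B ≡ p * (a * c + A) + (- c) * (a * p + B)
    ≡-Gauss-indep = solve-∀

    ≡-zero-lin : ∀ p q → p * 0ℤ + q * 0ℤ ≡ 0ℤ
    ≡-zero-lin = solve-∀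

  module _ {I : Set} where

    Zero-submodule : Submodule (Zero {I})
    Zero-submodule = record
      { null = λ w≡0 → w≡0
      ; lin = λ p q x≡0 y≡0 eq s → trans (eq s) (trans (cong₂ (λ x y → p * x + q * y) (x≡0 s) (y≡0 s)) (≡-zero-lin p q)) }

    module _ {B : Pt I → Set} (Bm : Submodule B) where

      Poly-cone : ∀ t {m} (v : Fin m → Pt I) → Cone B (Poly B t v)
      Poly-cone t v = record
        { comb = λ { {k} {l} {_} {x} {y} {w} p q 0≤p 0≤q (a , a-bd , ax) (b , b-bd , by) refl eq →
              (λ i → p * a i + q * b i)
            , (λ i → 0≤+ (0≤* 0≤p (proj₁ (a-bd i))) (0≤* 0≤q (proj₁ (b-bd i)))
                   , 0≤-resp (0≤+ (0≤* 0≤p (proj₂ (a-bd i))) (0≤* 0≤q (proj₂ (b-bd i))))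
                       (≡-Poly-bound p q k l (+ t) (a i) (b i)))
            , lin Bm p q ax by λ s → trans (cong₂ _-_ (eq s) (combine-lin p q a b v s))
                (≡-Poly-lin p q (x s) (y s) (combine a v s) (combine b v s)) }
        ; shift = λ { {k} {x} {b} (a , a-bd , ax) p bb eq → a , a-bd , lin Bm 1ℤ p ax bb
            λ s → trans (cong (_- combine a v s) (eq s)) (≡-Poly-shift (x s) p (b s) (combine a v s)) } }

      Mod-submodule : ∀ v → Submodule (Mod v B)
      Mod-submodule v = record
        { null = λ w≡0 → 0ℤ , null Bm λ s → cong (_- 0ℤ * v s) (w≡0 s)
        ; lin = λ { {x} {y} p q (c , bx) (d , by) eq → p * c + q * d , lin Bm p q bx by
            λ s → trans (cong (_- (p * c + q * d) * v s) (eq s)) (≡-Mod-lin p q (x s) (y s) c d (v s)) } }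

      Alternative-Mod : ∀ v → Nontorsion B v → Alternative B → Alternative (Mod v B)
      Alternative-Mod v nt alt r w = decide (alt (suc r) (v ◂ w))
        where
        decide : (∀ a → B (combine a (v ◂ w)) → ∀ i → a i ≡ 0ℤ) ⊎
                 (Σ[ a ∈ (Fin (suc r) → ℤ) ] (B (combine a (v ◂ w)) × ∃[ i ] a i ≢ 0ℤ)) →
                 (∀ a → Mod v B (combine a w) → ∀ i → a i ≡ 0ℤ) ⊎
                 (Σ[ a ∈ (Fin r → ℤ) ] (Mod v B (combine a w) × ∃[ i ] a i ≢ 0ℤ))
        decide (inj₁ ind) = inj₁ λ { a (c , b) i → ind (- c ◂ a)
          (resp Bm b λ s → ≡-neg-add c (v s) (combine a w s)) (suc i) }
        decide (inj₂ (a , b , suc i , ai≢0)) = inj₂ (a ∘ suc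
          , (- a zero , resp Bm b λ s → sym (≡-sub-neg′ (a zero) (v s) (combine (a ∘ suc) w s))) , i , ai≢0)
        decide (inj₂ (a , b , zero , a0≢0)) = inj₂ (a ∘ suc
          -- The nonzero coefficient found here is that of `v`. Were all the others zero, a nonzero
          -- multiple of `v` would lie in `B`; finite search then locates a nonzero one.
          , (- a zero , resp Bm b λ s → sym (≡-sub-neg′ (a zero) (v s) (combine (a ∘ suc) w s)))
          , ¬∀⟶∃¬ r (λ i → a (suc i) ≡ 0ℤ) (λ i → a (suc i) ℤ.≟ 0ℤ) λ a≡0 → a0≢0 (nt (a zero)
              (resp Bm b λ s → trans (≡-add-zero (a zero) (v s))
                (cong (λ z → a zero * v s + z) (sym (combine-zero w a≡0 s))))))

    -- Gaussian elimination: pivoting on a nonzero coordinate of the first vector.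
    Alternative-Zero : (∀ (x : Pt I) → Zero x ⊎ (∃[ s ] x s ≢ 0ℤ)) → Alternative Zero
    Alternative-Zero search zero w = inj₁ λ _ _ ()
    Alternative-Zero search (suc r) w = pivot (search (w zero))
      where
      Goal = (∀ a → Zero (combine a w) → ∀ i → a i ≡ 0ℤ) ⊎
             (Σ[ a ∈ (Fin (suc r) → ℤ) ] (Zero (combine a w) × ∃[ i ] a i ≢ 0ℤ))
      ws = w ∘ suc
      module _ (s : I) (p≢0 : w zero s ≢ 0ℤ) where
        p = w zero s
        -- Fraction-free elimination: the entries are 2 by 2 minors against the pivot column, and
        -- every `w′ j` vanishes at `s`.
        w′ : Fin r → Pt I
        w′ j u = p * ws j u - ws j s * w zero u
        combine-w′ : ∀ a u → combine a w′ u ≡ p * combine a ws u + (- w zero u) * combine a ws s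
        combine-w′ a u = trans (sum-cong {r} (λ j → ≡-Gauss-term (a j) p (ws j u) (ws j s) (w zero u)))
          (sum-lin p (- w zero u) (λ j → a j * ws j u) (λ j → a j * ws j s))
        eliminate : (∀ a → Zero (combine a w′) → ∀ i → a i ≡ 0ℤ) ⊎
                    (Σ[ a ∈ (Fin r → ℤ) ] (Zero (combine a w′) × ∃[ i ] a i ≢ 0ℤ)) → Goal
        -- Unfolding `w′` in the relation gives coefficient `p * a j` to each remaining vector and
        -- collects `- combine a ws s` on the pivot vector. As `p` is nonzero, the relation stays
        -- nontrivial.
        eliminate (inj₂ (a , z , j , aj≢0)) = inj₂ ((- combine a ws s ◂ λ j → p * a j)
          , (λ u → trans (cong (λ z → - combine a ws s * w zero u + z)
                     (trans (sum-cong {r} (λ j → ℤ.*-assoc p (a j) (ws j u))) (sum-scale p (λ j → a j * ws j u))))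
                   (trans (≡-Gauss-dep p (combine a ws u) (combine a ws s) (w zero u))
                     (trans (sym (combine-w′ a u)) (z u))))
          , suc j , λ eq → nonzero (ℤ.i*j≡0⇒i≡0∨j≡0 p eq))
          where
          nonzero : ¬ (p ≡ 0ℤ ⊎ a j ≡ 0ℤ)
          nonzero (inj₁ eq) = p≢0 eq
          nonzero (inj₂ eq) = aj≢0 eq
        eliminate (inj₁ ind) = inj₁ λ a z → λ { zero → a0≡0 a z ; (suc j) → rest a z j }
          where
          rest : ∀ a → Zero (combine a w) → ∀ j → a (suc j) ≡ 0ℤ
          rest a z = ind (a ∘ suc) λ u → trans (combine-w′ (a ∘ suc) u)
            (trans (≡-Gauss-indep p (combine (a ∘ suc) ws u) (combine (a ∘ suc) ws s) (a zero) (w zero u))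
              (trans (cong₂ (λ x y → p * x + (- w zero u) * y) (z u) (z s)) (≡-zero-lin p (- w zero u))))
          a0≡0 : ∀ a → Zero (combine a w) → a zero ≡ 0ℤ
          a0≡0 a z = nonpivot (ℤ.i*j≡0⇒i≡0∨j≡0 (a zero) (trans (≡-add-zero (a zero) p)
            (trans (cong (λ y → a zero * p + y) (sym (combine-zero ws (rest a z) s))) (z s))))
            where
            nonpivot : a zero ≡ 0ℤ ⊎ p ≡ 0ℤ → a zero ≡ 0ℤ
            nonpivot (inj₁ eq) = eq
            nonpivot (inj₂ eq) = ⊥-elim (p≢0 eq)
      pivot : Zero (w zero) ⊎ (∃[ s ] w zero s ≢ 0ℤ) → Goal
      pivot (inj₁ w0≡0) = inj₂ ((1ℤ ◂ λ _ → 0ℤ)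
        , (λ s → cong₂ (λ x y → 1ℤ * x + y) (w0≡0 s) (combine-zero ws (λ _ → refl) s)) , zero , λ ())
      pivot (inj₂ (s , p≢0)) = eliminate s p≢0 (Alternative-Zero search r (w′ s p≢0))

    In-mono : ∀ {P : Pt I → Set} {K K′ : Family I} → (∀ k y → K k y → K′ k y) → ∀ x → In P K x → In P K′ x
    In-mono KK′ x (px , k , pos , kx) = px , k , pos , KK′ _ _ kx

  module _ {I : Set} {B : Pt I → Set} (Bm : Submodule B) {m} (v : Fin (suc m) → Pt I) where
    private
      v₀ = v zero
      vs = v ∘ suc

    module _ (t : ℕ) where
      Poly⇒AddSegment : ∀ k y → Poly B t v k y → AddSegment t v₀ (Poly B t vs) k y
      Poly⇒AddSegment k y (a , bd , b) = a zero , proj₁ (bd zero) , proj₂ (bd zero) , a ∘ suc , bd ∘ suc ,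
        resp Bm b λ s → sym (≡-sub-sub (y s) (a zero) (v₀ s) (combine (a ∘ suc) vs s))

      AddSegment⇒Poly : ∀ k y → AddSegment t v₀ (Poly B t vs) k y → Poly B t v k y
      AddSegment⇒Poly k y (e , lo , hi , a , bd , b) = e ◂ a , (λ { zero → lo , hi ; (suc i) → bd i }) ,
        resp Bm b λ s → ≡-sub-sub (y s) e (v₀ s) (combine a vs s)

      -- The multiple of `v₀` that is divided out in the quotient is exactly the displacement along
      -- the line.
      Poly-Mod⇒Along : ∀ k y → Poly (Mod v₀ B) t vs k y → Along v₀ (Poly B t vs) k y
      Poly-Mod⇒Along k y (a , bd , c , b) = c , a , bd ,
        resp Bm b λ s → sym (≡-sub-comm (y s) c (v₀ s) (combine a vs s))

      Along⇒Poly-Mod : ∀ k y → Along v₀ (Poly B t vs) k y → Poly (Mod v₀ B) t vs k y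
      Along⇒Poly-Mod k y (c , a , bd , b) = a , bd , c ,
        resp Bm b λ s → ≡-sub-comm (y s) c (v₀ s) (combine a vs s)

    Span-contract : ∀ S y → Span B v (true ∷ S) y → Span (Mod v₀ B) vs S y
    Span-contract S y (a , b) = a ∘ suc , a zero ,
      resp Bm b λ s → sym (≡-sub-sub′ (y s) (a zero) (v₀ s) (combineOn S (a ∘ suc) vs s))

    Span-expand : ∀ S y → Span (Mod v₀ B) vs S y → Span B v (true ∷ S) y
    Span-expand S y (a , c , b) = c ◂ a ,
      resp Bm b λ s → ≡-sub-sub′ (y s) c (v₀ s) (combineOn S a vs s)

    Span-delete : ∀ S y → Span B v (false ∷ S) y → Span B vs S y
    Span-delete S y (a , b) = a ∘ suc , resp Bm b λ s →
      cong (λ z → y s - z) (sym (ℤ.+-identityˡ (combineOn S (a ∘ suc) vs s)))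

    Span-undelete : ∀ S y → Span B vs S y → Span B v (false ∷ S) y
    Span-undelete S y (a , b) = 0ℤ ◂ a , resp Bm b λ s →
      cong (λ z → y s - z) (ℤ.+-identityˡ (combineOn S a vs s))

    Indep-contract : ∀ S → Indep B v (true ∷ S) → Indep (Mod v₀ B) vs S
    Indep-contract S ind a (c , b) i i∈S = ind (- c ◂ a)
      (resp Bm b λ s → ≡-neg-add c (v₀ s) (combineOn S a vs s)) (suc i) (there i∈S)

    -- Independence in the quotient kills all coefficients except that of `v₀`; what remains is a
    -- multiple of `v₀` in `B`.
    Indep-expand : Nontorsion B v₀ → ∀ S → Indep (Mod v₀ B) vs S → Indep B v (true ∷ S)
    Indep-expand nt S ind a b = λ { zero _ → first ; (suc i) (there i∈S) → rest i i∈S }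
      where
      rest : ∀ i → i ∈ S → a (suc i) ≡ 0ℤ
      rest = ind (a ∘ suc) (- a zero , resp Bm b λ s → sym (≡-sub-neg′ (a zero) (v₀ s) (combineOn S (a ∘ suc) vs s)))
      first : a zero ≡ 0ℤ
      first = nt (a zero) (resp Bm b λ s → trans (≡-add-zero (a zero) (v₀ s))
        (cong (λ z → a zero * v₀ s + z) (sym (combineOn-zero S vs rest s))))

    Indep-nontorsion : ∀ S → Indep B v (true ∷ S) → Nontorsion B v₀
    Indep-nontorsion S ind c b = ind (c ◂ λ _ → 0ℤ) (resp Bm b λ s → trans
      (cong (λ z → c * v₀ s + z) (combineOn-zero S vs (λ _ _ → refl) s)) (sym (≡-add-zero c (v₀ s)))) zero here

    Indep-delete : ∀ S → Indep B v (false ∷ S) → Indep B vs S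
    Indep-delete S ind a b i i∈S = ind (0ℤ ◂ a)
      (resp Bm b λ s → ℤ.+-identityˡ (combineOn S a vs s)) (suc i) (there i∈S)

    Indep-undelete : ∀ S → Indep B vs S → Indep B v (false ∷ S)
    Indep-undelete S ind a b (suc i) (there i∈S) = ind (a ∘ suc)
      (resp Bm b λ s → sym (ℤ.+-identityˡ (combineOn S (a ∘ suc) vs s))) i i∈S

  -- Weighted sums over subsets

  weight : ∀ {m} → (Subset m → ℕ) → ℕ → Subset m → ℕ
  weight tor t S = tor S ℕ.* t ℕ.^ ∣ S ∣

  total : ∀ {m} → (Subset m → ℕ) → ℕ → ℕ
  total {m} tor t = sum (map (weight tor t) (allSubsets m))

  sum-scaled : ∀ {A : Set} t (f g : A → ℕ) → (∀ x → f x ≡ t ℕ.* g x) → ∀ xs → sum (map f xs) ≡ t ℕ.* sum (map g xs)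
  sum-scaled t f g eq List.[] = sym (ℕ.*-zeroʳ t)
  sum-scaled t f g eq (x List.∷ xs) = trans (cong₂ ℕ._+_ (eq x) (sum-scaled t f g eq xs))
    (sym (ℕ.*-distribˡ-+ t (g x) (sum (map g xs))))

  -- Subsets containing the first generator carry one extra factor `t`, which matches the recursion
  -- for the point counts.
  total-split : ∀ {m} (tor : Subset (suc m) → ℕ) t → total tor t ≡ t ℕ.* total (tor ∘ (true ∷_)) t ℕ.+ total (tor ∘ (false ∷_)) t
  total-split {m} tor t = begin
    sum (map f (map (true ∷_) L ++ map (false ∷_) L))
      ≡⟨ cong sum (List.map-++ f (map (true ∷_) L) (map (false ∷_) L)) ⟩
    sum (map f (map (true ∷_) L) ++ map f (map (false ∷_) L))
      ≡⟨ sum-++ (map f (map (true ∷_) L)) (map f (map (false ∷_) L)) ⟩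
    sum (map f (map (true ∷_) L)) ℕ.+ sum (map f (map (false ∷_) L))
      ≡⟨ cong₂ (λ xs ys → sum xs ℕ.+ sum ys) (List.map-∘ L) (List.map-∘ L) ⟨
    sum (map (f ∘ (true ∷_)) L) ℕ.+ total (tor ∘ (false ∷_)) t
      ≡⟨ cong (ℕ._+ total (tor ∘ (false ∷_)) t)
           (sum-scaled t _ _ (λ S → ℕ*.x∙yz≈y∙xz (tor (true ∷ S)) t (t ℕ.^ ∣ S ∣)) L) ⟩
    t ℕ.* total (tor ∘ (true ∷_)) t ℕ.+ total (tor ∘ (false ∷_)) t ∎
    where
    open ≡-Reasoning
    f = weight tor t
    L = allSubsets m

  total-zero : ∀ {m} (tor : Subset m → ℕ) t → (∀ S → tor S ≡ 0) → total tor t ≡ 0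
  total-zero {m} tor t tor≡0 = sum-scaled 0 _ (λ _ → 0) (λ S → cong (ℕ._* t ℕ.^ ∣ S ∣) (tor≡0 S)) (allSubsets m)

  -- The deletion-contraction induction

  module _ {I : Set} {P : Pt I → Set} (Pm : Submodule P) (t : ℕ) where

    -- `B` and `tor` are quantified inside the induction: deletion keeps `B` and restricts `tor` to
    -- sets avoiding the first generator, while contraction passes to `Mod v₀ B` and the sets
    -- containing it.
    Enum-zonotope : ∀ {m} (v : Fin m → Pt I) → (∀ i → P (v i)) →
      ∀ {B} → Submodule B → Alternative B → (tor : Subset m → ℕ) →
      (∀ S → Indep B v S → Enum (Span B v S) (Tors P (Span B v S)) (Fin (tor S))) →
      (∀ S → ¬ Indep B v S → tor S ≡ 0) →
      Enum B (In P (Poly B t v)) (Fin (total tor t))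
    Enum-zonotope {zero} v Pv {B} Bm alt tor enum none =
      subst (λ N → Enum B (In P (Poly B t v)) (Fin N)) (sym (trans (ℕ.+-identityʳ _) (ℕ.*-identityʳ (tor []))))
        -- Without generators both `Span` and `Poly` are `B` up to subtracting zero, so the torsion
        -- enumeration of the empty set is already the required one.
        (Enum-⇔ {B = Span B v []} {B′ = B} {Q = Tors P (Span B v [])} {Q′ = In P (Poly B t v)}
          (λ { x (_ , b) → resp Bm b λ s → sym (≡-sub-zero′ (x s)) })
          (λ x b → (λ ()) , resp Bm b λ s → ≡-sub-zero′ (x s))
          (In-mono {K = λ _ → Span B v []} {K′ = Poly B t v} λ { k y (a , b) → a , (λ ()) , b })
          (In-mono {K = Poly B t v} {K′ = λ _ → Span B v []} λ { k y (a , _ , b) → a , b })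
          (enum [] λ _ _ ()))
    Enum-zonotope {suc m} v Pv {B} Bm alt tor enum none = step (alt 1 (λ _ → v₀))
      where
      v₀ = v zero
      vs = v ∘ suc
      E₂ : Enum B (In P (Poly B t vs)) (Fin (total (tor ∘ (false ∷_)) t))
      E₂ = Enum-zonotope vs (Pv ∘ suc) Bm alt (tor ∘ (false ∷_))
        (λ S ind → Enum-⇔ (Span-delete Bm v S) (Span-undelete Bm v S)
          (In-mono λ _ → Span-delete Bm v S) (In-mono λ _ → Span-undelete Bm v S)
          (enum (false ∷ S) (Indep-undelete Bm v S ind)))
        (λ S ¬ind → none (false ∷ S) (¬ind ∘ Indep-delete Bm v S))
      finish : Enum B (In P (AddSegment t v₀ (Poly B t vs)))
                      (Fin (t ℕ.* total (tor ∘ (true ∷_)) t ℕ.+ total (tor ∘ (false ∷_)) t)) →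
               Enum B (In P (Poly B t v)) (Fin (total tor t))
      finish E = subst (λ N → Enum B (In P (Poly B t v)) (Fin N)) (sym (total-split tor t))
        (Enum-⇔ {B = B} {B′ = B} (λ _ b → b) (λ _ b → b)
          (In-mono (AddSegment⇒Poly Bm v t)) (In-mono (Poly⇒AddSegment Bm v t)) E)
      nontorsion : Nontorsion B v₀ → Enum B (In P (Poly B t v)) (Fin (total tor t))
      nontorsion nt = finish (Enum-nontorsion Bm Pm v₀ (Pv zero) t (Poly-cone Bm t vs) nt
        (Enum-⇔ {B = Mod v₀ B} {B′ = Mod v₀ B} (λ _ b → b) (λ _ b → b)
          (In-mono (Poly-Mod⇒Along Bm v t)) (In-mono (Along⇒Poly-Mod Bm v t))
          (Enum-zonotope vs (Pv ∘ suc) (Mod-submodule Bm v₀) (Alternative-Mod Bm v₀ nt alt) (tor ∘ (true ∷_))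
            (λ S ind → Enum-⇔ (Span-contract Bm v S) (Span-expand Bm v S)
              (In-mono λ _ → Span-contract Bm v S) (In-mono λ _ → Span-expand Bm v S)
              (enum (true ∷ S) (Indep-expand Bm v nt S ind)))
            (λ S ¬ind → none (true ∷ S) (¬ind ∘ Indep-contract Bm v S))))
        E₂)
      torsion : ∀ q → q ≢ 0ℤ → Pos q → B (λ s → q * v₀ s) → Enum B (In P (Poly B t v)) (Fin (total tor t))
      -- Every set containing a torsion generator is dependent, so `none` annihilates the
      -- contraction summand and only the deletion count is left.
      torsion q q≢0 pos bq = finish (subst (λ N → Enum B (In P (AddSegment t v₀ (Poly B t vs))) (Fin N))
        (sym (cong (ℕ._+ total (tor ∘ (false ∷_)) t) (trans (cong (t ℕ.*_)
          (total-zero (tor ∘ (true ∷_)) t λ S → none (true ∷ S) λ ind → q≢0 (Indep-nontorsion Bm v S ind q bq)))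
          (ℕ.*-zeroʳ t))))
        (Enum-torsion Bm Pm v₀ (Pv zero) t (Poly-cone Bm t vs) q pos bq E₂))
      torsion′ : ∀ q → q ≢ 0ℤ → B (λ s → q * v₀ s) → Enum B (In P (Poly B t v)) (Fin (total tor t))
      torsion′ (+ zero) q≢0 _ = ⊥-elim (q≢0 refl)
      torsion′ (+ suc n) q≢0 bq = torsion (+ suc n) q≢0 (0≤k-1⇒Pos (+≤+ ℕ.z≤n)) bq
      torsion′ -[1+ n ] q≢0 bq = torsion (+ suc n) (λ ()) (0≤k-1⇒Pos (+≤+ ℕ.z≤n))
        (scale Bm (- 1ℤ) bq λ s → neg (+ suc n) (v₀ s))
        where
        neg : ∀ q v → q * v ≡ - 1ℤ * (- q * v)
        neg = solve-∀
      step : (∀ a → B (combine {m = 1} a (λ _ → v₀)) → ∀ i → a i ≡ 0ℤ) ⊎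
             (Σ[ a ∈ (Fin 1 → ℤ) ] (B (combine a (λ _ → v₀)) × ∃[ i ] a i ≢ 0ℤ)) →
             Enum B (In P (Poly B t v)) (Fin (total tor t))
      step (inj₁ ind) = nontorsion λ c b → ind (λ _ → c) (resp Bm b λ s → sym (≡-add-zero c (v₀ s))) zero
      step (inj₂ (a , b , zero , a≢0)) = torsion′ (a zero) a≢0 (resp Bm b λ s → ≡-add-zero (a zero) (v₀ s))

open Zonotope

-- Clearing denominators

toℚᵘ-toℚ : ∀ z → toℚᵘ (toℚ z) ℚᵘ.≃ mkℚᵘ z 0
toℚᵘ-toℚ z = ℚ.toℚᵘ-fromℚᵘ (mkℚᵘ z 0)

toℚ-+ : ∀ a b → toℚ (a ℤ.+ b) ≡ toℚ a ℚ.+ toℚ b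
toℚ-+ a b = ℚ.toℚᵘ-injective (begin
  toℚᵘ (toℚ (a ℤ.+ b)) ≈⟨ toℚᵘ-toℚ (a ℤ.+ b) ⟩
  mkℚᵘ (a ℤ.+ b) 0 ≈⟨ *≡* (lem a b) ⟩
  mkℚᵘ a 0 ℚᵘ.+ mkℚᵘ b 0 ≈⟨ ℚᵘ.+-cong (toℚᵘ-toℚ a) (toℚᵘ-toℚ b) ⟨
  toℚᵘ (toℚ a) ℚᵘ.+ toℚᵘ (toℚ b) ≈⟨ ℚ.toℚᵘ-homo-+ (toℚ a) (toℚ b) ⟨
  toℚᵘ (toℚ a ℚ.+ toℚ b) ∎)
  where
  open ℚᵘ.≃-Reasoning
  lem : ∀ a b → (a ℤ.+ b) ℤ.* 1ℤ ≡ (a ℤ.* 1ℤ ℤ.+ b ℤ.* 1ℤ) ℤ.* 1ℤ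
  lem = solve-∀

toℚ-* : ∀ a b → toℚ (a ℤ.* b) ≡ toℚ a ℚ.* toℚ b
toℚ-* a b = ℚ.toℚᵘ-injective (begin
  toℚᵘ (toℚ (a ℤ.* b)) ≈⟨ toℚᵘ-toℚ (a ℤ.* b) ⟩
  mkℚᵘ (a ℤ.* b) 0 ≈⟨ *≡* refl ⟩
  mkℚᵘ a 0 ℚᵘ.* mkℚᵘ b 0 ≈⟨ ℚᵘ.*-cong (toℚᵘ-toℚ a) (toℚᵘ-toℚ b) ⟨
  toℚᵘ (toℚ a) ℚᵘ.* toℚᵘ (toℚ b) ≈⟨ ℚ.toℚᵘ-homo-* (toℚ a) (toℚ b) ⟨
  toℚᵘ (toℚ a ℚ.* toℚ b) ∎)
  where
  open ℚᵘ.≃-Reasoning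

toℚ-injective : ∀ {a b} → toℚ a ≡ toℚ b → a ≡ b
toℚ-injective {a} {b} eq with ℚᵘ.≃-trans (ℚᵘ.≃-sym (toℚᵘ-toℚ a)) (ℚᵘ.≃-trans (ℚ.toℚᵘ-cong eq) (toℚᵘ-toℚ b))
... | *≡* p = trans (sym (ℤ.*-identityʳ a)) (trans p (ℤ.*-identityʳ b))

toℚ-mono : ∀ {a b} → a ℤ.≤ b → toℚ a ℚ.≤ toℚ b
toℚ-mono {a} {b} a≤b = ℚ.toℚᵘ-cancel-≤
  (ℚᵘ.≤-respˡ-≃ (ℚᵘ.≃-sym (toℚᵘ-toℚ a)) (ℚᵘ.≤-respʳ-≃ (ℚᵘ.≃-sym (toℚᵘ-toℚ b))
    (*≤* (subst₂ ℤ._≤_ (sym (ℤ.*-identityʳ a)) (sym (ℤ.*-identityʳ b)) a≤b))))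

toℚ-cancel : ∀ {a b} → toℚ a ℚ.≤ toℚ b → a ℤ.≤ b
toℚ-cancel {a} {b} a≤b with ℚᵘ.≤-respˡ-≃ (toℚᵘ-toℚ a) (ℚᵘ.≤-respʳ-≃ (toℚᵘ-toℚ b) (ℚ.toℚᵘ-mono-≤ a≤b))
... | *≤* p = subst₂ ℤ._≤_ (ℤ.*-identityʳ a) (ℤ.*-identityʳ b) p

module _ {k : ℤ} (pos : Pos k) where
  private
    positive : ∀ k → Pos k → ℚ.Positive (toℚ k)
    positive (+ suc n) _ = ℚ.normalize-pos (suc n) 1
    positive (+ zero) (0≤k-1⇒Pos ())
    positive -[1+ n ] (0≤k-1⇒Pos ())

    instance
      k-pos : ℚ.Positive (toℚ k)
      k-pos = positive k pos

      k-nonNeg : ℚ.NonNegative (toℚ k)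
      k-nonNeg = ℚ.pos⇒nonNeg (toℚ k)

  toℚ-mul-mono : ∀ {p q} → p ℚ.≤ q → toℚ k ℚ.* p ℚ.≤ toℚ k ℚ.* q
  toℚ-mul-mono = ℚ.*-monoˡ-≤-nonNeg (toℚ k)

  toℚ-mul-cancel-≤ : ∀ {p q} → toℚ k ℚ.* p ℚ.≤ toℚ k ℚ.* q → p ℚ.≤ q
  toℚ-mul-cancel-≤ = ℚ.*-cancelˡ-≤-pos (toℚ k)

  toℚ-mul-injective : ∀ {p q} → toℚ k ℚ.* p ≡ toℚ k ℚ.* q → p ≡ q
  toℚ-mul-injective eq = ℚ.≤-antisym (toℚ-mul-cancel-≤ (ℚ.≤-reflexive eq)) (toℚ-mul-cancel-≤ (ℚ.≤-reflexive (sym eq)))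

  toℚ-quotient : ∀ a → Σ[ q ∈ ℚ ] toℚ k ℚ.* q ≡ toℚ a
  toℚ-quotient a = ℚ.1/ toℚ k ℚ.* toℚ a , trans (sym (ℚ.*-assoc (toℚ k) (ℚ.1/ toℚ k) (toℚ a)))
    (trans (cong (ℚ._* toℚ a) (ℚ.*-inverseʳ (toℚ k))) (ℚ.*-identityˡ (toℚ a)))
    where instance _ = ℚ.pos⇒nonZero (toℚ k)

↧-* : ∀ q → toℚ (↧ q) ℚ.* q ≡ toℚ (↥ q)
↧-* q@record{} = ℚ.toℚᵘ-injective (begin
  toℚᵘ (toℚ (↧ q) ℚ.* q) ≈⟨ ℚ.toℚᵘ-homo-* (toℚ (↧ q)) q ⟩
  toℚᵘ (toℚ (↧ q)) ℚᵘ.* toℚᵘ q ≈⟨ ℚᵘ.*-congʳ {toℚᵘ q} (toℚᵘ-toℚ (↧ q)) ⟩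
  mkℚᵘ (↧ q) 0 ℚᵘ.* toℚᵘ q ≈⟨ *≡* (trans (ℤ.*-identityʳ _) (trans (ℤ.*-comm (↧ q) (↥ q)) (cong (↥ q ℤ.*_) (sym (ℤ.*-identityˡ (↧ q)))))) ⟩
  mkℚᵘ (↥ q) 0 ≈⟨ toℚᵘ-toℚ (↥ q) ⟨
  toℚᵘ (toℚ (↥ q)) ∎)
  where
  open ℚᵘ.≃-Reasoning

-- The product of all denominators serves as `k`; its positivity preserves the bounds on the
-- coefficients.
clear-denominators : ∀ {m} (l : Fin m → ℚ) →
  Σ[ k ∈ ℤ ] (Pos k × (Σ[ a ∈ (Fin m → ℤ) ] (∀ i → toℚ k ℚ.* l i ≡ toℚ (a i))))
clear-denominators {zero} l = 1ℤ , 0≤k-1⇒Pos (ℤ.+≤+ ℕ.z≤n) , (λ ()) , λ ()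
clear-denominators {suc m} l with clear-denominators (l ∘ suc)
... | k , pos , a , eq = ↧ q ℤ.* k , Pos-* {↧ l zero} (0≤k-1⇒Pos (ℤ.i≤j⇒0≤j-i (ℤ.+≤+ (ℕ.s≤s ℕ.z≤n)))) pos , a′ , eq′
  where
  q = l zero
  a′ : Fin (suc m) → ℤ
  a′ zero = k ℤ.* ↥ q
  a′ (suc i) = ↧ q ℤ.* a i
  eq′ : ∀ i → toℚ (↧ q ℤ.* k) ℚ.* l i ≡ toℚ (a′ i)
  eq′ zero = trans (cong (ℚ._* q) (trans (cong toℚ (ℤ.*-comm (↧ q) k)) (toℚ-* k (↧ q))))
    (trans (ℚ.*-assoc (toℚ k) (toℚ (↧ q)) q) (trans (cong (toℚ k ℚ.*_) (↧-* q)) (sym (toℚ-* k (↥ q)))))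
  eq′ (suc i) = trans (cong (ℚ._* l (suc i)) (toℚ-* (↧ q) k))
    (trans (ℚ.*-assoc (toℚ (↧ q)) (toℚ k) (l (suc i)))
      (trans (cong (toℚ (↧ q) ℚ.*_) (eq i)) (sym (toℚ-* (↧ q) (a i)))))

sum-toℚ : ∀ {m} k (f : Fin m → ℚ) (g : Fin m → ℤ) → (∀ i → toℚ k ℚ.* f i ≡ toℚ (g i)) →
  toℚ k ℚ.* sumFinℚ f ≡ toℚ (sumFinℤ g)
sum-toℚ {zero} k f g eq = ℚ.*-zeroʳ (toℚ k)
sum-toℚ {suc m} k f g eq = trans (ℚ.*-distribˡ-+ (toℚ k) (f zero) (sumFinℚ (f ∘ suc)))
  (trans (cong₂ ℚ._+_ (eq zero) (sum-toℚ k (f ∘ suc) (g ∘ suc) (eq ∘ suc)))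
         (sym (toℚ-+ (g zero) (sumFinℤ (g ∘ suc)))))

mul-toℚ : ∀ k l a w → toℚ k ℚ.* l ≡ toℚ a → toℚ k ℚ.* (l ℚ.* toℚ w) ≡ toℚ (a ℤ.* w)
mul-toℚ k l a w eq = trans (sym (ℚ.*-assoc (toℚ k) l (toℚ w)))
  (trans (cong (ℚ._* toℚ w) eq) (sym (toℚ-* a w)))

-- Hypergraphs

-- There are only finitely many subsets to search; this supplies the pivots of the elimination.
zero-or-nonzero : ∀ {n} (x : Chain n) → Zero x ⊎ (∃[ s ] x s ≢ 0ℤ)
zero-or-nonzero x with anySubset? (λ s → ¬? (x s ℤ.≟ 0ℤ))
... | yes found = inj₂ found
... | no none = inj₁ λ s → decidable-stable (x s ℤ.≟ 0ℤ) λ x≢0 → none (s , x≢0)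

module _ {d n : ℕ} (H : Hypergraph d n) where
  private
    v = bdEdge H

  combineOn-∈? : ∀ S a s →
    combineOn S a v s ≡ sumFinℤ (λ i → if ⌊ i ∈? S ⌋ then a i ℤ.* v i s else 0ℤ)
  combineOn-∈? S a s = sum-cong {m H} λ i →
    cong (λ b → if b then a i ℤ.* v i s else 0ℤ) (sym (∈?-lookup S i))

  masked-toℚ : ∀ S (l : Fin (m H) → ℚ) k a → (∀ i → toℚ k ℚ.* l i ≡ toℚ (a i)) → ∀ s →
    toℚ k ℚ.* sumFinℚ (λ i → if ⌊ i ∈? S ⌋ then l i ℚ.* toℚ (v i s) else 0ℚ) ≡ toℚ (combineOn S a v s)
  masked-toℚ S l k a eq s = trans
    (sum-toℚ k _ (λ i → if ⌊ i ∈? S ⌋ then a i ℤ.* v i s else 0ℤ) λ i → mask ⌊ i ∈? S ⌋ i)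
    (cong toℚ (sym (combineOn-∈? S a s)))
    where
    mask : ∀ b i → toℚ k ℚ.* (if b then l i ℚ.* toℚ (v i s) else 0ℚ) ≡ toℚ (if b then a i ℤ.* v i s else 0ℤ)
    mask true i = mul-toℚ k (l i) (a i) (v i s) (eq i)
    mask false i = ℚ.*-zeroʳ (toℚ k)

  -- A common denominator turns a rational relation into an integral one with the same vanishing
  -- coefficients.
  Indep⇒IsHyperforest : ∀ S → Indep Zero v S → IsHyperforest H S
  Indep⇒IsHyperforest S ind l l≡0 i i∈S =
    let (k , pos , a , eq) = clear-denominators l
        a≡0 = ind a (λ s → toℚ-injective {combineOn S a v s} {0ℤ} (trans (sym (masked-toℚ S l k a eq s))
                (trans (cong (toℚ k ℚ.*_) (l≡0 s)) (ℚ.*-zeroʳ (toℚ k))))) i i∈S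
    in toℚ-mul-injective pos (trans (eq i) (trans (cong toℚ a≡0) (sym (ℚ.*-zeroʳ (toℚ k)))))

  IsHyperforest⇒Indep : ∀ S → IsHyperforest H S → Indep Zero v S
  IsHyperforest⇒Indep S hf a a≡0 i i∈S = toℚ-injective {a i} {0ℤ} (hf (toℚ ∘ a)
    (λ s → toℚ-mul-injective {1ℤ} (0≤k-1⇒Pos (+≤+ ℕ.z≤n))
      (trans (masked-toℚ S (toℚ ∘ a) 1ℤ a (λ i → ℚ.*-identityˡ (toℚ (a i))) s) (cong toℚ (a≡0 s)))) i i∈S)

  InB⇒Span : ∀ S y → InB H S y → Span Zero v S y
  InB⇒Span S y (a , eq) = a , λ s → ℤ.i≡j⇒i-j≡0 (trans (eq s) (sym (combineOn-∈? S a s)))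

  Span⇒InB : ∀ S y → Span Zero v S y → InB H S y
  Span⇒InB S y (a , eq) = a , λ s → trans (ℤ.i-j≡0⇒i≡j (y s) (combineOn S a v s) (eq s)) (combineOn-∈? S a s)

  IsTors⇒Tors : ∀ S z → IsTors H S z → Tors (IsCycle H) (Span Zero v S) z
  IsTors⇒Tors S z (cyc , k , b) = cyc , + suc k , 0≤k-1⇒Pos (+≤+ ℕ.z≤n) , InB⇒Span S _ b

  Tors⇒IsTors : ∀ S z → Tors (IsCycle H) (Span Zero v S) z → IsTors H S z
  Tors⇒IsTors S z (cyc , + suc k , _ , b) = cyc , k , Span⇒InB S _ b
  Tors⇒IsTors S z (cyc , + zero , 0≤k-1⇒Pos () , b)
  Tors⇒IsTors S z (cyc , -[1+ _ ] , 0≤k-1⇒Pos () , b)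

  module _ (t : ℕ) where

    sum-combine : ∀ (l : Fin (m H) → ℚ) k a → (∀ i → toℚ k ℚ.* l i ≡ toℚ (a i)) → ∀ s →
      toℚ k ℚ.* sumFinℚ (λ i → l i ℚ.* toℚ (v i s)) ≡ toℚ (combine a v s)
    sum-combine l k a eq s = sum-toℚ k (λ i → l i ℚ.* toℚ (v i s)) (λ i → a i ℤ.* v i s)
      λ i → mul-toℚ k (l i) (a i) (v i s) (eq i)

    -- The common denominator of the coefficients becomes the multiplier `k`; the bounds `0` and `t`
    -- become `0` and `k t` for the numerators.
    InDilate⇒In : ∀ x → IsCycle H x → InDilate H t x → In (IsCycle H) (Poly Zero t v) x
    InDilate⇒In x cyc (l , bounds , eqx) =
      let (k , pos , a , eq) = clear-denominators l
      in cyc , k , pos , a , (λ i → lower k pos (a i) i (eq i) , upper k pos (a i) i (eq i)) , point k a eq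
      where
      lower : ∀ k → Pos k → ∀ a i → toℚ k ℚ.* l i ≡ toℚ a → 0ℤ ℤ.≤ a
      lower k pos a i eq = toℚ-cancel {0ℤ} {a} (subst (ℚ._≤ toℚ a) (ℚ.*-zeroʳ (toℚ k))
        (subst (toℚ k ℚ.* 0ℚ ℚ.≤_) eq (toℚ-mul-mono pos (proj₁ (bounds i)))))
      upper : ∀ k → Pos k → ∀ a i → toℚ k ℚ.* l i ≡ toℚ a → 0ℤ ℤ.≤ k ℤ.* + t ℤ.- a
      upper k pos a i eq = ℤ.i≤j⇒0≤j-i (toℚ-cancel {a} {k ℤ.* + t} (subst (ℚ._≤ toℚ (k ℤ.* + t)) eq
        (subst (toℚ k ℚ.* l i ℚ.≤_) (sym (toℚ-* k (+ t))) (toℚ-mul-mono pos (proj₂ (bounds i))))))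
      point : ∀ k a → (∀ i → toℚ k ℚ.* l i ≡ toℚ (a i)) → ∀ s → k ℤ.* x s ℤ.- combine a v s ≡ 0ℤ
      point k a eq s = ℤ.i≡j⇒i-j≡0 (toℚ-injective {k ℤ.* x s} {combine a v s} (trans (toℚ-* k (x s))
        (trans (cong (toℚ k ℚ.*_) (eqx s)) (sum-combine l k a eq s))))

    In⇒InDilate : ∀ x → In (IsCycle H) (Poly Zero t v) x → IsCycle H x × InDilate H t x
    In⇒InDilate x (cyc , k , pos , a , bounds , eqx) = cyc , l ,
      (λ i → toℚ-mul-cancel-≤ pos (subst (toℚ k ℚ.* 0ℚ ℚ.≤_) (sym (eq i))
               (subst (ℚ._≤ toℚ (a i)) (sym (ℚ.*-zeroʳ (toℚ k))) (toℚ-mono {0ℤ} {a i} (proj₁ (bounds i)))))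
           , toℚ-mul-cancel-≤ pos (subst (ℚ._≤ toℚ k ℚ.* toℚ (+ t)) (sym (eq i))
               (subst (toℚ (a i) ℚ.≤_) (toℚ-* k (+ t)) (toℚ-mono {a i} {k ℤ.* + t} (ℤ.0≤i-j⇒j≤i (proj₂ (bounds i))))))) ,
      λ s → toℚ-mul-injective pos (trans (sym (toℚ-* k (x s)))
        (trans (cong toℚ (ℤ.i-j≡0⇒i≡j (k ℤ.* x s) (combine a v s) (eqx s))) (sym (sum-combine l k a eq s))))
      where
      l : Fin (m H) → ℚ
      l i = proj₁ (toℚ-quotient pos (a i))
      eq : ∀ i → toℚ k ℚ.* l i ≡ toℚ (a i)
      eq i = proj₂ (toℚ-quotient pos (a i))

    Enum⇒LatticeCount : ∀ {N} → Enum Zero (In (IsCycle H) (Poly Zero t v)) (Fin N) → LatticeCount H t N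
    Enum⇒LatticeCount (f , mem , inj , cov) = f , (λ i → In⇒InDilate (f i) (mem i)) ,
      (λ i j eq → inj i j λ s → ℤ.i≡j⇒i-j≡0 (eq s)) ,
      λ x cyc dil → let (i , eq) = cov x (InDilate⇒In x cyc dil) in
        i , λ s → sym (ℤ.i-j≡0⇒i≡j (x s) (f i s) (eq s))

open import Data.Nat using (_≤_; _*_; _^_)

theorem3p1 : (d n : ℕ) → 1 ≤ d → (H : Hypergraph d n) →
    (tor : Subset (m H) → ℕ) →
    (∀ S → IsHyperforest H S → TorsOrder H S (tor S)) →
    (∀ S → ¬ IsHyperforest H S → tor S ≡ 0) →
    (t : ℕ) → 1 ≤ t →
    LatticeCount H t (sum (map (λ S → tor S * t ^ ∣ S ∣) (allSubsets (m H))))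
theorem3p1 d n _ H tor torsOrder tor≡0 t _ = Enum⇒LatticeCount H t
  (Enum-zonotope (IsCycle-submodule H) t (bdEdge H) (bdEdge-cycle H)
    Zero-submodule (Alternative-Zero zero-or-nonzero) tor
    -- `TorsOrder H S` unfolds to an `Enum` for `InB H S` and `IsTors H S`, so only these two
    -- predicates have to be translated.
    (λ S ind → Enum-⇔ (InB⇒Span H S) (Span⇒InB H S) (IsTors⇒Tors H S) (Tors⇒IsTors H S)
      (torsOrder S (Indep⇒IsHyperforest H S ind)))
    (λ S ¬ind → tor≡0 S (¬ind ∘ IsHyperforest⇒Indep H S)))
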